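{- Let $G$ be a near-triangulation that does not contain $K_4$ as an induced subgraph. Then $G$ is word-representable if and only if $G$ is internally even, i.e. every inner vertex of $G$ has even degree.
   Context: A near-triangulation is a (finite) planar graph, given with a plane embedding, in which every bounded face is a triangle; the outer face need not be a triangle. An inner vertex is a vertex not incident to the outer face. A graph $G=(V,E)$ is word-representable if there is a word $w$ over the alphabet $V$ such that for all distinct $x,y\in V$, the letters $x$ and $y$ alternate in $w$ if and only if $(x,y)\in E$. -}

module Defs where

open import Data.Bool.Base using (Bool; not; T)
open import Data.Bool.Properties using (T?)
open import Data.Fin.Base using (Fin; _<_)
open import Data.Fin.Properties using (_≟_; _<?_)
open import Data.Fin.Subset using (Subset; ∣_∣)
open import Data.List.Base using (List; []; _∷_; allFin; cartesianProduct; filter; length)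
open import Data.Nat.Base using (ℕ; _+_)
open import Data.Nat.Divisibility using (_∣_)
open import Data.Nat.GeneralisedArithmetic using (iterate)
open import Data.Product.Base using (∃-syntax; Σ-syntax; _×_; _,_)
open import Data.Sum.Base using (_⊎_; inj₁; inj₂)
open import Data.Vec.Base using (tabulate)
open import Function.Bundles using (_⇔_; _↔_; Inverse)
open import Function.Definitions using (Injective; Surjective)
open import Level using (0ℓ)
open import Relation.Binary.Construct.Closure.Equivalence using (EqClosure)
open import Relation.Binary.Construct.Closure.ReflexiveTransitive using (Star)
open import Relation.Binary.Core using (Rel)
open import Relation.Binary.Definitions using (Symmetric; Irreflexive)
open import Relation.Binary.PropositionalEquality using (_≡_; _≢_; sym)
open import Relation.Nullary.Decidable.Core using (yes; no; ⌊_⌋; _×-dec_; _⊎-dec_)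
open import Relation.Nullary.Negation.Core using (¬_; contradiction)

record Graph (n : ℕ) : Set where
  field
    adj : Fin n → Fin n → Bool

  Adj : Rel (Fin n) 0ℓ
  Adj u v = T (adj u v)

  field
    adj-sym    : Symmetric Adj
    adj-irrefl : Irreflexive _≡_ Adj

  neighbours : Fin n → Subset n
  neighbours v = tabulate (adj v)

  degree : Fin n → ℕ
  degree v = ∣ neighbours v ∣

  edges : List (Fin n × Fin n)
  edges = filter (λ (u , v) → (u <? v) ×-dec T? (adj u v))
                 (cartesianProduct (allFin n) (allFin n))

  record Dart : Set where
    eta-equality
    constructor dart
    field
      source target : Fin n
      edge          : Adj source target

  open Dart public

  rev : Dart → Dart
  rev (dart u v e) = dart v u (adj-sym e)

complete : ∀ n → Graph n
complete n = record
  { adj        = λ i j → not ⌊ i ≟ j ⌋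
  ; adj-sym    = λ {i} {j} → symmetric i j
  ; adj-irrefl = λ {i} {j} → irreflexive i j
  }
  where
  symmetric : ∀ i j → T (not ⌊ i ≟ j ⌋) → T (not ⌊ j ≟ i ⌋)
  symmetric i j p with i ≟ j | j ≟ i
  ... | no i≢j | yes j≡i = contradiction (sym j≡i) i≢j
  ... | no _   | no _    = p

  irreflexive : ∀ i j → i ≡ j → ¬ T (not ⌊ i ≟ j ⌋)
  irreflexive i j i≡j p with i ≟ j
  ... | no i≢j = i≢j i≡j

ContainsInduced : ∀ {m n} → Graph m → Graph n → Set
ContainsInduced {m} {n} H G =
  Σ[ f ∈ (Fin m → Fin n) ] Injective _≡_ _≡_ f ×
    (∀ i j → Graph.Adj H i j ⇔ Graph.Adj G (f i) (f j))

-- AlternatesFrom x y w : w is a finite prefix of x y x y x y ...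
data AlternatesFrom {A : Set} (x y : A) : List A → Set where
  []  : AlternatesFrom x y []
  _∷_ : ∀ {z w} → z ≡ x → AlternatesFrom y x w → AlternatesFrom x y (z ∷ w)

restrict : ∀ {n} → Fin n → Fin n → List (Fin n) → List (Fin n)
restrict x y = filter (λ z → (z ≟ x) ⊎-dec (z ≟ y))

Alternate : ∀ {n} → Fin n → Fin n → List (Fin n) → Set
Alternate x y w =
  AlternatesFrom x y (restrict x y w) ⊎ AlternatesFrom y x (restrict x y w)

WordRepresentable : ∀ {n} → Graph n → Set
WordRepresentable {n} G =
  ∃[ w ] (∀ (x y : Fin n) → x ≢ y → Alternate x y w ⇔ Graph.Adj G x y)

-- A corner is an angle between cyclically consecutive edges at a vertex,
-- named by one of its two darts; an isolated vertex has a single corner.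
module _ {n : ℕ} (G : Graph n) where
  open Graph G

  data Corner : Set where
    at       : Dart → Corner
    isolated : (v : Fin n) → degree v ≡ 0 → Corner

module _ {n : ℕ} {G : Graph n} where
  open Graph G

  vertex : Corner G → Fin n
  vertex (at d)         = source d
  vertex (isolated v _) = v

record RotationSystem {n : ℕ} (G : Graph n) : Set where
  open Graph G

  field
    rotation : Dart ↔ Dart

  rotate : Dart → Dart
  rotate = Inverse.to rotation

  field
    rotate-source : ∀ d → source (rotate d) ≡ source d
    rotate-cyclic : ∀ d e → source d ≡ source e → ∃[ k ] iterate rotate d k ≡ e

  -- The orbits of next are the boundary walks of faces.
  next : Corner G → Corner G
  next (at d)         = at (rotate (rev d))
  next (isolated v p) = isolated v p

data Touch {n f : ℕ} (G : Graph n) (face : Corner G → Fin f) :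
           Rel (Fin n ⊎ Fin f) 0ℓ where
  adjacent : ∀ {u v} → Graph.Adj G u v → Touch G face (inj₁ u) (inj₁ v)
  corner   : ∀ c → Touch G face (inj₁ (vertex c)) (inj₂ (face c))

-- An embedding in the plane, up to homeomorphism, of a graph that need not
-- be connected: a rotation system together with the assignment of
-- boundary walks to faces.  A face can have several boundary walks,
-- which belong to different components of the graph.

record PlaneEmbedding {n : ℕ} (G : Graph n) : Set where
  open Graph G

  field
    rotationSystem : RotationSystem G

  open RotationSystem rotationSystem public

  field
    #faces    : ℕ
    outer     : Fin #faces
    face      : Corner G → Fin #faces
    face-next : ∀ c → face (next c) ≡ face c

    #components          : ℕ
    component            : Fin n → Fin #components
    component-surjective : Surjective _≡_ _≡_ component
    component-connected  : ∀ u v → component u ≡ component v ⇔ Star Adj u v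

    -- Write V, E, F, C for the numbers of vertices, edges, faces, components,
    -- B for the number of boundary walks, and g for the sum of the genera of
    -- the components, so that V - E + B = 2C - 2g.  The bipartite graph of
    -- components against faces, with an edge for each boundary walk, is
    -- connected by the first condition, so B ≥ C + F - 1, whereas the second
    -- gives B = C + F - 1 - 2g.  Hence g = 0 and that graph is a tree, which
    -- characterises the embeddings in the sphere.
    connected : ∀ x y → EqClosure (Touch G face) x y
    euler     : n + #faces ≡ length edges + (1 + #components)

  Incident : Fin n → Fin #faces → Set
  Incident v F = ∃[ c ] vertex c ≡ v × face c ≡ F

  -- The boundary of F is a single closed walk of length three.
  IsTriangle : Fin #faces → Set
  IsTriangle F = Σ[ d ∈ Dart ]
    next (next (next (at d))) ≡ at d ×
    (∀ c → face c ≡ F ⇔ (c ≡ at d ⊎ c ≡ next (at d) ⊎ c ≡ next (next (at d))))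

  IsNearTriangulation : Set
  IsNearTriangulation = ∀ F → F ≢ outer → IsTriangle F

  Inner : Fin n → Set
  Inner v = ¬ Incident v outer

  InternallyEven : Set
  InternallyEven = ∀ v → Inner v → 2 ∣ degree v

{-# OPTIONS --safe #-}
-- If a word w represents G, compare the neighbours x of a vertex v by the
-- number of occurrences of x in the prefixes of w, shifted by one if v leads x.
-- Distinct neighbours are adjacent if and only if they are comparable, so that
-- without K₄ there is no chain of three neighbours.  Consecutive neighbours of
-- an inner vertex are adjacent, hence comparisons alternately go up and down
-- around it, and its degree is even.
--
-- Conversely, alternating signs can be put on the darts around each vertex, up
-- to a global sign at the vertex.  The bounded faces have no first cohomology,
-- by Euler's formula.  With coefficients ℤ/2 this allows the global signs to be
-- chosen so that the darts d and rev d have opposite signs for every d; the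
-- three darts of a triangle then have equal signs.  Read as ±1 in ℤ/3, the
-- signs are a cocycle, and a potential for it is a 3-colouring.  A graph with
-- a 3-colouring is word-representable.
module Submission where

open import Defs
open import Algebra.Bundles using (Group)
open import Algebra.Structures using (IsGroup)
import Algebra.Properties.Group as GroupProperties
open import Axiom.UniquenessOfIdentityProofs using (module Decidable⇒UIP)
open import Data.Bool.Base using (Bool; true; false; not; T; if_then_else_; _xor_)
open import Data.Bool.Properties using (T?; T-irrelevant; not-involutive; not-¬; not-distribˡ-xor; xor-assoc; xor-comm; xor-identity; xor-same)
open import Data.Empty using (⊥-elim)
open import Data.Fin.Base as Fin using (Fin; zero; suc; toℕ; fromℕ<; inject≤; _↑ˡ_; _↑ʳ_; splitAt; finToFun; funToFin; punchOut)
open import Data.Fin.Patterns using (0F; 1F; 2F; 3F; 4F)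
open import Data.Fin.Permutation using (↔⇒≡)
open import Data.Fin.Properties as Fin using (_≟_; all?; any?; 2↔Bool; toℕ<n; toℕ-fromℕ<; toℕ-injective; splitAt-↑ˡ; splitAt-↑ʳ; join-splitAt; finToFun-funToFin; funToFin-finToFin; punchOut-injective; <⇒notInjective)
open import Data.Fin.Subset using (Subset; ∣_∣)
open import Data.List.Base as List using (List; []; _∷_; [_]; _++_; allFin; cartesianProduct; concatMap; filter; length)
open import Data.List.Membership.Propositional using (_∈_)
open import Data.List.Membership.Propositional.Properties using (∈-allFin; ∈-cartesianProduct⁺; ∈-filter⁺; ∈-filter⁻; ∈-lookup; ∈-∃++)
open import Data.List.Properties using (map-++; filter-++; filter-none; filter-≐; concatMap-++; ≡-dec)
open import Data.List.Relation.Unary.All as All using (All; []; _∷_)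
open import Data.List.Relation.Unary.All.Properties using (all-filter)
open import Data.List.Relation.Unary.AllPairs using (_∷_)
open import Data.List.Relation.Unary.Any as Any using (here; there)
open import Data.List.Relation.Unary.Any.Properties using (lookup-index)
open import Data.List.Relation.Unary.Unique.Propositional using (Unique)
open import Data.List.Relation.Unary.Unique.Propositional.Properties using (allFin⁺; filter⁺)
open import Data.Maybe.Base using (Maybe; just; nothing)
open import Data.Maybe.Properties as Maybe using (just-injective)
open import Data.Nat.Base as ℕ using (ℕ; zero; suc; _+_; _*_; _∸_; _^_; _⊔_; _≤_; _<_; z≤n; s≤s; z<s; s≤s⁻¹)
open import Data.Nat.Divisibility using (_∣_; divides; ∣-refl; _∣0; ∣m∣n⇒∣m+n)
open import Data.Nat.DivMod using (_%_; _/_; _mod_; m≡m%n+[m/n]*n; m%n<n)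
open import Data.Nat.GeneralisedArithmetic using (iterate)
import Data.Nat.Properties as ℕ
open import Data.Product.Base as Product using (Σ-syntax; ∃; ∃-syntax; _×_; _,_; proj₁; proj₂)
open import Data.Sum.Base as Sum using (_⊎_; inj₁; inj₂; swap; [_,_]′)
open import Data.Vec.Base as Vec using (_∷_)
open import Data.Vec.Properties using (lookup∘tabulate)
open import Function.Base using (_∘_; id; const)
open import Function.Bundles using (_⇔_; mk⇔; Equivalence; _↔_; mk↔ₛ′; Inverse; Injection)
open import Function.Construct.Composition using (_↔-∘_)
open import Function.Construct.Identity using (↔-id)
open import Function.Construct.Symmetry using (↔-sym)
open import Function.Definitions using (Injective)
open import Function.Properties.Inverse using (↔⇒↣)
open import Relation.Binary.Construct.Closure.Equivalence using (EqClosure)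
open import Relation.Binary.Construct.Closure.ReflexiveTransitive using (Star; ε; _◅_)
open import Relation.Binary.Construct.Closure.Symmetric using (fwd; bwd)
open import Relation.Binary.Definitions using (DecidableEquality; tri<; tri≈; tri>)
open import Relation.Binary.PropositionalEquality using (_≡_; _≢_; _≗_; refl; sym; trans; cong; cong₂; subst; subst₂; isEquivalence; module ≡-Reasoning)
open import Relation.Nullary.Decidable.Core using (Dec; yes; no; ⌊_⌋; map′; _×-dec_; _⊎-dec_; _→-dec_; ¬?; from-yes)
open import Relation.Nullary.Negation.Core using (¬_; contradiction)
open import Relation.Unary using (Decidable)

-- Words from 3-colourings

filter-unique : ∀ {A : Set} {P : A → Set} (P? : Decidable P) {x xs} →
                Unique xs → x ∈ xs → P x → (∀ {y} → y ∈ xs → P y → y ≡ x) → filter P? xs ≡ [ x ]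
filter-unique P? {x} {z ∷ xs} (z∉xs ∷ uniq) x∈ px only with P? z
... | yes pz rewrite only (here refl) pz = cong (x ∷_) (filter-none P?
        (All.tabulate λ y∈xs py → All.lookup z∉xs y∈xs (sym (only (there y∈xs) py))))
... | no ¬pz with x∈
...   | here refl = contradiction px ¬pz
...   | there x∈xs = filter-unique P? uniq x∈xs px (only ∘ there)

module _ {n : ℕ} (x y : Fin n) where

  pair? : Decidable (λ z → z ≡ x ⊎ z ≡ y)
  pair? z = (z ≟ x) ⊎-dec (z ≟ y)

  restrict-++ : ∀ v w → restrict x y (v ++ w) ≡ restrict x y v ++ restrict x y w
  restrict-++ = filter-++ pair?

restrict-comm : ∀ {n} (x y : Fin n) w → restrict x y w ≡ restrict y x w
restrict-comm x y = filter-≐ (pair? x y) (pair? y x) (swap , swap)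

Alternate-sym : ∀ {n} {x y : Fin n} w → Alternate x y w → Alternate y x w
Alternate-sym {x = x} {y} w rewrite restrict-comm x y w = swap

module _ {A : Set} where

  alternates-prefix : ∀ {x y : A} p {q} → AlternatesFrom x y (p ++ q) → AlternatesFrom x y p
  alternates-prefix []      _          = []
  alternates-prefix (z ∷ p) (eq ∷ alt) = eq ∷ alternates-prefix p alt

  alternates-suffix : ∀ {x y : A} p {q} → AlternatesFrom x y (p ++ q) →
                      AlternatesFrom x y q ⊎ AlternatesFrom y x q
  alternates-suffix []      alt       = inj₁ alt
  alternates-suffix (z ∷ p) (_ ∷ alt) = swap (alternates-suffix p alt)

  -- Both admissible prefixes have even length, so `x` is again the letter due when `q` begins.
  alternates-repeats : ∀ {x y : A} {p q} → p ≡ [] ⊎ p ≡ x ∷ y ∷ x ∷ y ∷ [] →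
                       AlternatesFrom x y q → AlternatesFrom x y (p ++ q)
  alternates-repeats (inj₁ refl) alt = alt
  alternates-repeats (inj₂ refl) alt = refl ∷ refl ∷ refl ∷ refl ∷ alt

-- One factor in which two letters fail to alternate thus spoils the whole word. The restriction of
-- `p` may have odd length, in which case the two letters swap roles.
Alternate-infix : ∀ {n} {x y : Fin n} p w q → Alternate x y (p ++ w ++ q) → Alternate x y w
Alternate-infix {x = x} {y} p w q
  rewrite restrict-++ x y p (w ++ q) | restrict-++ x y w q = λ where
    (inj₁ alt) → suffix-prefix alt
    (inj₂ alt) → swap (suffix-prefix alt)
  where
  suffix-prefix : ∀ {a b} → AlternatesFrom a b (restrict x y p ++ restrict x y w ++ restrict x y q) →
                  AlternatesFrom a b (restrict x y w) ⊎ AlternatesFrom b a (restrict x y w)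
  suffix-prefix alt with alternates-suffix (restrict x y p) alt
  ... | inj₁ alt′ = inj₁ (alternates-prefix (restrict x y w) alt′)
  ... | inj₂ alt′ = inj₂ (alternates-prefix (restrict x y w) alt′)

module BlowUp {n k : ℕ} (label : Fin n → Fin k) where

  block : Fin k → List (Fin n)
  block s = filter (λ v → label v ≟ s) (allFin n)

  blowUp : List (Fin k) → List (Fin n)
  blowUp = concatMap block

  ∈-block : ∀ v → v ∈ block (label v)
  ∈-block v = ∈-filter⁺ (λ u → label u ≟ label v) (∈-allFin v) refl

  block-unique : ∀ s → Unique (block s)
  block-unique s = filter⁺ (λ v → label v ≟ s) (allFin⁺ n)

  label-block : ∀ {v s} → v ∈ block s → label v ≡ s
  label-block {s = s} v∈ = proj₂ (∈-filter⁻ (λ u → label u ≟ s) {xs = allFin n} v∈)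

  module _ {x y : Fin n} (lx≢ly : label x ≢ label y) where

    letter : Fin k → Fin n
    letter s with s ≟ label x
    ... | yes _ = x
    ... | no  _ = y

    letter-x : letter (label x) ≡ x
    letter-x with label x ≟ label x
    ... | yes _ = refl
    ... | no ¬p = contradiction refl ¬p

    letter-y : letter (label y) ≡ y
    letter-y with label y ≟ label x
    ... | yes p = contradiction (sym p) lx≢ly
    ... | no  _ = refl

    restrict-block : ∀ s → restrict x y (block s) ≡ List.map letter (restrict (label x) (label y) [ s ])
    restrict-block s with s ≟ label x
    ... | yes refl = trans
      (filter-unique (pair? x y) (block-unique _) (∈-block x) (inj₁ refl) λ where
        _  (inj₁ eq)   → eq
        v∈ (inj₂ refl) → contradiction (sym (label-block v∈)) lx≢ly)
      (cong [_] (sym letter-x))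
    ... | no s≢lx with s ≟ label y
    ...   | yes refl = trans
      (filter-unique (pair? x y) (block-unique _) (∈-block y) (inj₂ refl) λ where
        v∈ (inj₁ refl) → contradiction (label-block v∈) lx≢ly
        _  (inj₂ eq)   → eq)
      (cong [_] (sym letter-y))
    ...   | no s≢ly = filter-none (pair? x y) (All.tabulate λ where
        v∈ (inj₁ refl) → s≢lx (sym (label-block v∈))
        v∈ (inj₂ refl) → s≢ly (sym (label-block v∈)))

    -- A vertex occurs exactly once in the block of its own label and in no other block. Alternation
    -- of two vertices with different labels is thereby reduced to a fixed word over `Fin k`,
    -- whatever the size of the graph.
    restrict-blowUp : ∀ S → restrict x y (blowUp S) ≡ List.map letter (restrict (label x) (label y) S)
    restrict-blowUp []      = refl
    restrict-blowUp (s ∷ S) = begin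
      restrict x y (block s ++ blowUp S)
        ≡⟨ restrict-++ x y (block s) (blowUp S) ⟩
      restrict x y (block s) ++ restrict x y (blowUp S)
        ≡⟨ cong₂ _++_ (restrict-block s) (restrict-blowUp S) ⟩
      List.map letter (restrict (label x) (label y) [ s ]) ++ List.map letter (restrict (label x) (label y) S)
        ≡⟨ map-++ letter (restrict (label x) (label y) [ s ]) _ ⟨
      List.map letter (restrict (label x) (label y) [ s ] ++ restrict (label x) (label y) S)
        ≡⟨ cong (List.map letter) (restrict-++ (label x) (label y) [ s ] S) ⟨
      List.map letter (restrict (label x) (label y) (s ∷ S))
        ∎
      where open ≡-Reasoning

-- Labels 0, 1, 2 stand for the colour classes without x and y, and 3, 4 for x
-- and y, of colours a ≤ b.  In the word labelWord a b every two letters of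
-- different colours alternate, the smaller colour first, except for x and y.
labelWord : Fin 3 → Fin 3 → List (Fin 5)
labelWord 0F 0F = 3F ∷ 4F ∷ 0F ∷ 1F ∷ 2F ∷ 4F ∷ 3F ∷ 0F ∷ 1F ∷ 2F ∷ []
labelWord 1F 1F = 0F ∷ 3F ∷ 4F ∷ 1F ∷ 2F ∷ 0F ∷ 4F ∷ 3F ∷ 1F ∷ 2F ∷ []
labelWord 2F 2F = 0F ∷ 1F ∷ 3F ∷ 4F ∷ 2F ∷ 0F ∷ 1F ∷ 4F ∷ 3F ∷ 2F ∷ []
labelWord 0F 1F = 3F ∷ 0F ∷ 1F ∷ 4F ∷ 2F ∷ 0F ∷ 4F ∷ 3F ∷ 1F ∷ 2F ∷ []
labelWord 1F 2F = 0F ∷ 3F ∷ 1F ∷ 2F ∷ 4F ∷ 0F ∷ 1F ∷ 4F ∷ 3F ∷ 2F ∷ []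
labelWord 0F 2F = 3F ∷ 0F ∷ 1F ∷ 2F ∷ 3F ∷ 4F ∷ 0F ∷ 1F ∷ 2F ∷ 4F ∷ []
-- Here `a > b`. Such a pair contributes nothing; the same pair in the opposite order takes care of
-- it.
labelWord _  _  = []

labelColour : Fin 3 → Fin 3 → Fin 5 → Fin 3
labelColour a b 0F = 0F
labelColour a b 1F = 1F
labelColour a b 2F = 2F
labelColour a b 3F = a
labelColour a b 4F = b

module _ (a b : Fin 3) (s t : Fin 5) where

  Repeats : Set
  Repeats = restrict s t (labelWord a b) ≡ [] ⊎ restrict s t (labelWord a b) ≡ s ∷ t ∷ s ∷ t ∷ []

  repeats? : Dec (labelColour a b s Fin.< labelColour a b t → ¬ (s ≡ 3F × t ≡ 4F) → Repeats)
  repeats? = (_ Fin.<? _) →-dec (¬? ((s ≟ 3F) ×-dec (t ≟ 4F)) →-dec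
             (≡-dec _≟_ _ _ ⊎-dec ≡-dec _≟_ _ _))

-- A finite check. Only one order of the special labels is excepted: if `s` is `4F` and `t` is `3F`,
-- then `b < a` and the word is empty.
labelWord-repeats : ∀ a b s t → labelColour a b s Fin.< labelColour a b t →
                    ¬ (s ≡ 3F × t ≡ 4F) → Repeats a b s t
labelWord-repeats = from-yes (all? λ a → all? λ b → all? λ s → all? λ t → repeats? a b s t)

module _ (a b : Fin 3) where

  Breaks : Set
  Breaks = restrict 3F 4F (labelWord a b) ≡ 3F ∷ 4F ∷ 4F ∷ 3F ∷ []
         ⊎ restrict 3F 4F (labelWord a b) ≡ 3F ∷ 3F ∷ 4F ∷ 4F ∷ []

  breaks? : Dec (a Fin.≤ b → Breaks)
  breaks? = (a Fin.≤? b) →-dec (≡-dec _≟_ _ _ ⊎-dec ≡-dec _≟_ _ _)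

labelWord-breaks : ∀ a b → a Fin.≤ b → Breaks a b
labelWord-breaks = from-yes (all? λ a → all? λ b → breaks? a b)

module ThreeColouring {n : ℕ} (G : Graph n) (colour : Fin n → Fin 3)
                      (proper : ∀ {u v} → Graph.Adj G u v → colour u ≢ colour v) where
  open Graph G

  module Piece (x y : Fin n) where

    label : Fin n → Fin 5
    label v with v ≟ x | v ≟ y
    ... | yes _ | _     = 3F
    ... | no  _ | yes _ = 4F
    ... | no  _ | no  _ = inject≤ (colour v) (ℕ.m≤m+n 3 2)

    labelColour-label : ∀ v → labelColour (colour x) (colour y) (label v) ≡ colour v
    labelColour-label v with v ≟ x | v ≟ y
    ... | yes refl | _        = refl
    ... | no  _    | yes refl = refl
    ... | no  _    | no  _ with colour v
    ...   | 0F = refl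
    ...   | 1F = refl
    ...   | 2F = refl

    label≡3 : ∀ {v} → label v ≡ 3F → v ≡ x
    label≡3 {v} eq with v ≟ x | v ≟ y
    ... | yes v≡x | _ = v≡x
    ... | no _ | no _ with colour v
    label≡3 () | no _ | no _ | 0F
    label≡3 () | no _ | no _ | 1F
    label≡3 () | no _ | no _ | 2F

    label≡4 : ∀ {v} → label v ≡ 4F → v ≡ y
    label≡4 {v} eq with v ≟ x | v ≟ y
    ... | no _ | yes v≡y = v≡y
    ... | no _ | no _ with colour v
    label≡4 () | no _ | no _ | 0F
    label≡4 () | no _ | no _ | 1F
    label≡4 () | no _ | no _ | 2F

    label-x : label x ≡ 3F
    label-x with x ≟ x
    ... | yes _   = refl
    ... | no  x≢x = contradiction refl x≢x

    label-y : x ≢ y → label y ≡ 4F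
    label-y x≢y with y ≟ x | y ≟ y
    ... | yes y≡x | _       = contradiction (sym y≡x) x≢y
    ... | no  _   | yes _   = refl
    ... | no  _   | no  y≢y = contradiction refl y≢y

    open BlowUp label public

    piece : List (Fin n)
    piece = blowUp (labelWord (colour x) (colour y))

    -- The excepted labels would identify `u` and `v` with the non-adjacent `x` and `y`. Every piece
    -- shows the ends of an edge in the same order, the smaller colour first, and evenly often, so
    -- that concatenating pieces keeps them alternating.
    piece-repeats : ∀ {u v} → ¬ Adj x y → Adj u v → colour u Fin.< colour v →
      restrict u v piece ≡ [] ⊎ restrict u v piece ≡ u ∷ v ∷ u ∷ v ∷ []
    piece-repeats {u} {v} ¬xy uv u<v =
      Sum.map (λ eq → trans restricted (cong (List.map ltr) eq))
              (λ eq → trans restricted (trans (cong (List.map ltr) eq) letters))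
        (labelWord-repeats (colour x) (colour y) (label u) (label v)
          (subst₂ Fin._<_ (sym (labelColour-label u)) (sym (labelColour-label v)) u<v)
          λ (lu , lv) → ¬xy (subst₂ Adj (label≡3 lu) (label≡4 lv) uv))
      where
      lu≢lv : label u ≢ label v
      lu≢lv eq = ℕ.<⇒≢ u<v (cong toℕ (trans (sym (labelColour-label u))
        (trans (cong (labelColour _ _) eq) (labelColour-label v))))
      ltr = letter lu≢lv
      restricted = restrict-blowUp lu≢lv (labelWord (colour x) (colour y))
      letters : List.map ltr (label u ∷ label v ∷ label u ∷ label v ∷ []) ≡ u ∷ v ∷ u ∷ v ∷ []
      letters = cong₂ (λ a b → a ∷ b ∷ a ∷ b ∷ []) (letter-x lu≢lv) (letter-y lu≢lv)

    piece-breaks : x ≢ y → colour x Fin.≤ colour y → ¬ Alternate x y piece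
    piece-breaks x≢y x≤y = [ broken₁ , broken₂ ]′ (labelWord-breaks (colour x) (colour y) x≤y)
      where
      lx≢ly : label x ≢ label y
      lx≢ly eq with () ← trans (sym label-x) (trans eq (label-y x≢y))
      ltr = letter lx≢ly

      restricted : restrict x y piece ≡ List.map ltr (restrict 3F 4F (labelWord (colour x) (colour y)))
      restricted = trans (restrict-blowUp lx≢ly (labelWord (colour x) (colour y)))
        (cong₂ (λ s t → List.map ltr (restrict s t (labelWord (colour x) (colour y)))) label-x (label-y x≢y))

      ltr-3 : ltr 3F ≡ x
      ltr-3 = trans (cong ltr (sym label-x)) (letter-x lx≢ly)
      ltr-4 : ltr 4F ≡ y
      ltr-4 = trans (cong ltr (sym (label-y x≢y))) (letter-y lx≢ly)

      broken₁ : restrict 3F 4F (labelWord (colour x) (colour y)) ≡ 3F ∷ 4F ∷ 4F ∷ 3F ∷ [] →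
                ¬ Alternate x y piece
      broken₁ eq alt rewrite trans restricted (cong (List.map ltr) eq) with alt
      ... | inj₁ (_ ∷ _ ∷ eq₃ ∷ _) = x≢y (trans (sym eq₃) ltr-4)
      ... | inj₂ (eq₁ ∷ _)         = x≢y (trans (sym ltr-3) eq₁)

      broken₂ : restrict 3F 4F (labelWord (colour x) (colour y)) ≡ 3F ∷ 3F ∷ 4F ∷ 4F ∷ [] →
                ¬ Alternate x y piece
      broken₂ eq alt rewrite trans restricted (cong (List.map ltr) eq) with alt
      ... | inj₁ (_ ∷ eq₂ ∷ _) = x≢y (trans (sym ltr-3) eq₂)
      ... | inj₂ (eq₁ ∷ _)     = x≢y (trans (sym ltr-3) eq₁)

  NonEdge : Fin n × Fin n → Set
  NonEdge (x , y) = ¬ Adj x y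

  -- Pairs are ordered, and the diagonal is included. The piece of a diagonal pair is harmless,
  -- since `piece-repeats` asks only that the pair be non-adjacent.
  nonEdges : List (Fin n × Fin n)
  nonEdges = filter (λ (x , y) → ¬? (T? (adj x y))) (cartesianProduct (allFin n) (allFin n))

  piece : Fin n × Fin n → List (Fin n)
  piece (x , y) = Piece.piece x y

  word : List (Fin n)
  word = concatMap piece nonEdges

  repeats-alternate : ∀ {u v} → Adj u v → colour u Fin.< colour v → ∀ ps → All NonEdge ps →
                      AlternatesFrom u v (restrict u v (concatMap piece ps))
  repeats-alternate uv u<v [] [] = []
  repeats-alternate {u} {v} uv u<v ((x , y) ∷ ps) (¬xy ∷ ¬ps) =
    subst (AlternatesFrom u v) (sym (restrict-++ u v (piece (x , y)) (concatMap piece ps)))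
      (alternates-repeats (Piece.piece-repeats x y ¬xy uv u<v) (repeats-alternate uv u<v ps ¬ps))

  adj⇒alternates : ∀ {u v} → Adj u v → colour u Fin.< colour v → Alternate u v word
  adj⇒alternates uv u<v = inj₁ (repeats-alternate uv u<v nonEdges
    (all-filter (λ (x , y) → ¬? (T? (adj x y))) (cartesianProduct (allFin n) (allFin n))))

  nonAdj⇒breaks : ∀ {x y} → x ≢ y → ¬ Adj x y → colour x Fin.≤ colour y → ¬ Alternate x y word
  nonAdj⇒breaks {x} {y} x≢y ¬xy x≤y alt
    with ps , qs , eq ← ∈-∃++ (∈-filter⁺ (λ (x , y) → ¬? (T? (adj x y)))
           (∈-cartesianProduct⁺ (∈-allFin x) (∈-allFin y)) ¬xy) =
    Piece.piece-breaks x y x≢y x≤y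
      (Alternate-infix (concatMap piece ps) (piece (x , y)) (concatMap piece qs)
        (subst (Alternate x y) (trans (cong (concatMap piece) eq) (concatMap-++ piece ps _)) alt))

  wordRepresentable : WordRepresentable G
  wordRepresentable = word , λ x y x≢y → mk⇔ (to x≢y) from
    where
    to : ∀ {x y} → x ≢ y → Alternate x y word → Adj x y
    to {x} {y} x≢y alt with T? (adj x y)
    ... | yes xy = xy
    ... | no ¬xy with Fin.≤-total (colour x) (colour y)
    ...   | inj₁ x≤y = contradiction alt (nonAdj⇒breaks x≢y ¬xy x≤y)
    ...   | inj₂ y≤x = contradiction (Alternate-sym word alt)
                         (nonAdj⇒breaks (x≢y ∘ sym) (¬xy ∘ adj-sym) y≤x)

    from : ∀ {x y} → Adj x y → Alternate x y word
    from {x} {y} xy with Fin.<-cmp (colour x) (colour y)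
    ... | tri< x<y _ _ = adj⇒alternates xy x<y
    ... | tri≈ _ eq _  = contradiction eq (proper xy)
    ... | tri> _ _ y<x = Alternate-sym word (adj⇒alternates (adj-sym xy) y<x)

-- Iteration, and rotations around a vertex

least : ∀ {P : ℕ → Set} → Decidable P → ∀ k → P k →
        ∃[ m ] P m × (∀ {j} → j < m → ¬ P j)
least P? zero p = zero , p , λ ()
least P? (suc k) p with P? zero
... | yes p₀ = zero , p₀ , λ ()
... | no ¬p₀ with least (P? ∘ suc) k p
...   | m , q , min = suc m , q , λ { {zero} _ → ¬p₀ ; {suc j} (s≤s j<m) → min j<m }

module _ {A : Set} (f : A → A) where

  iterate-+ : ∀ x m n → iterate f x (m + n) ≡ iterate f (iterate f x m) n
  iterate-+ x zero    n = refl
  iterate-+ x (suc m) n = iterate-+ (f x) m n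

  iterate-suc : ∀ x n → iterate f x (suc n) ≡ f (iterate f x n)
  iterate-suc x zero    = refl
  iterate-suc x (suc n) = iterate-suc (f x) n

  iterate-* : ∀ {x m} → iterate f x m ≡ x → ∀ k → iterate f x (k * m) ≡ x
  iterate-* eq zero = refl
  iterate-* {x} {m} eq (suc k) = begin
    iterate f x (m + k * m)           ≡⟨ iterate-+ x m (k * m) ⟩
    iterate f (iterate f x m) (k * m) ≡⟨ cong (λ y → iterate f y (k * m)) eq ⟩
    iterate f x (k * m)               ≡⟨ iterate-* eq k ⟩
    x                                 ∎
    where open ≡-Reasoning

  iterate-injective : Injective _≡_ _≡_ f → ∀ n → Injective _≡_ _≡_ (λ x → iterate f x n)
  iterate-injective inj zero    eq = eq
  iterate-injective inj (suc n) eq = inj (iterate-injective inj n eq)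

Member : ∀ {n} → Subset n → Set
Member {n} p = Σ[ i ∈ Fin n ] T (Vec.lookup p i)

member-≡ : ∀ {n} (p : Subset n) {x y : Member p} → proj₁ x ≡ proj₁ y → x ≡ y
member-≡ _ refl = cong (_ ,_) (T-irrelevant _ _)

Fin∣p∣↔Member : ∀ {n} (p : Subset n) → Fin ∣ p ∣ ↔ Member p
Fin∣p∣↔Member p = mk↔ₛ′ (enum p) (rank p) (enum-rank p) (rank-enum p)
  where
  enum : ∀ {n} (p : Subset n) → Fin ∣ p ∣ → Member p
  enum (true ∷ p)  zero    = zero , _
  enum (true ∷ p)  (suc i) = Product.map suc id (enum p i)
  enum (false ∷ p) i       = Product.map suc id (enum p i)

  rank : ∀ {n} (p : Subset n) → Member p → Fin ∣ p ∣
  rank (true ∷ p)  (zero , _)  = zero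
  rank (true ∷ p)  (suc i , t) = suc (rank p (i , t))
  rank (false ∷ p) (suc i , t) = rank p (i , t)

  enum-rank : ∀ {n} (p : Subset n) x → enum p (rank p x) ≡ x
  enum-rank (true ∷ p)  (zero , _)  = refl
  enum-rank (true ∷ p)  (suc i , t) = cong (Product.map suc id) (enum-rank p (i , t))
  enum-rank (false ∷ p) (suc i , t) = cong (Product.map suc id) (enum-rank p (i , t))

  rank-enum : ∀ {n} (p : Subset n) i → rank p (enum p i) ≡ i
  rank-enum (true ∷ p)  zero    = refl
  rank-enum (true ∷ p)  (suc i) = cong suc (rank-enum p i)
  rank-enum (false ∷ p) i       = rank-enum p i

module _ {n : ℕ} {G : Graph n} where
  open Graph G

  dart-≡ : ∀ {d e : Dart} → source d ≡ source e → target d ≡ target e → d ≡ e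
  dart-≡ refl refl = cong (dart _ _) (T-irrelevant _ _)

  _≟ᵈ_ : DecidableEquality Dart
  d ≟ᵈ e = map′ (λ (p , q) → dart-≡ p q) (λ { refl → refl , refl })
                (source d ≟ source e ×-dec target d ≟ target e)

  source≢target : ∀ d → source d ≢ target d
  source≢target d eq = adj-irrefl eq (edge d)

  any-dart? : ∀ {P : Dart → Set} → Decidable P → Dec (∃ P)
  any-dart? {P} P? = map′ (λ (u , v , e , p) → dart u v e , p)
                      (λ (dart u v e , p) → u , v , e , p)
                      (any? λ u → any? λ v → any-edge? u v)
    where
    any-edge? : ∀ u v → Dec (∃[ e ] P (dart u v e))
    any-edge? u v with T? (adj u v)
    ... | no ¬e = no λ (e , _) → ¬e e
    ... | yes e = map′ (e ,_) (λ (e′ , p) → subst (λ e → P (dart u v e)) (T-irrelevant e′ e) p) (P? (dart u v e))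

  degree≢0⇒dart : ∀ {v} → degree v ≢ 0 → ∃[ d ] source d ≡ v
  degree≢0⇒dart {v} deg≢0 with degree v in eq | Inverse.to (Fin∣p∣↔Member (neighbours v))
  ... | zero  | _    = contradiction refl deg≢0
  ... | suc _ | enum with enum zero
  ...   | u , t = dart v u (subst T (lookup∘tabulate (adj v) u) t) , refl

  dart⇒degree≢0 : ∀ d → degree (source d) ≢ 0
  dart⇒degree≢0 d eq with degree (source d) | eq | Inverse.from (Fin∣p∣↔Member (neighbours (source d)))
  ... | .0 | refl | rank with () ← rank (target d , subst T (sym (lookup∘tabulate (adj (source d)) (target d))) (edge d))

  module Rotation (R : RotationSystem G) where
    open RotationSystem R

    rotate-injective : Injective _≡_ _≡_ rotate
    rotate-injective = Injection.injective (↔⇒↣ rotation)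

    iterate-source : ∀ d k → source (iterate rotate d k) ≡ source d
    iterate-source d zero    = refl
    iterate-source d (suc k) = trans (iterate-source (rotate d) k) (rotate-source d)

    -- Storing the predecessor makes the period visibly positive, which the reduction modulo
    -- `period` in `index` relies on.
    record Period (d : Dart) : Set where
      field
        predPeriod : ℕ
        closes     : iterate rotate d (suc predPeriod) ≡ d
        minimal    : ∀ {j} → j < predPeriod → iterate rotate d (suc j) ≢ d

      period : ℕ
      period = suc predPeriod

      -- Cancelling `j` rotations on both sides leaves a return of `d` to itself after `k ∸ j`
      -- steps, which `minimal` excludes.
      no-return : ∀ {j k} → j < k → k < period → iterate rotate d j ≢ iterate rotate d k
      no-return {j} {k} j<k k<p eq = minimal {k ∸ suc j}
        (ℕ.≤-trans (ℕ.∸-monoʳ-< {k} (ℕ.n<1+n j) j<k) (ℕ.≤-trans (ℕ.m∸n≤m k j) (s≤s⁻¹ k<p)))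
        (iterate-injective rotate rotate-injective j (begin
          iterate rotate (iterate rotate d (suc (k ∸ suc j))) j
            ≡⟨ iterate-+ rotate d (suc (k ∸ suc j)) j ⟨
          iterate rotate d (suc (k ∸ suc j) + j)
            ≡⟨ cong (iterate rotate d) (trans (sym (ℕ.+-suc (k ∸ suc j) j)) (ℕ.m∸n+n≡m j<k)) ⟩
          iterate rotate d k
            ≡⟨ eq ⟨
          iterate rotate d j
            ∎))
        where open ≡-Reasoning

      unique : ∀ {j k} → j < period → k < period →
               iterate rotate d j ≡ iterate rotate d k → j ≡ k
      unique {j} {k} j<p k<p eq with ℕ.<-cmp j k
      ... | tri< j<k _ _ = contradiction eq (no-return j<k k<p)
      ... | tri≈ _ j≡k _ = j≡k
      ... | tri> _ _ k<j = contradiction (sym eq) (no-return k<j j<p)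

      index : ∀ e → source e ≡ source d → ∃[ k ] k < period × iterate rotate d k ≡ e
      index e eq with rotate-cyclic d e (sym eq)
      ... | k , ends = k % period , m%n<n k period , (begin
        iterate rotate d (k % period)
          ≡⟨ cong (λ x → iterate rotate x (k % period)) (iterate-* rotate closes (k / period)) ⟨
        iterate rotate (iterate rotate d (k / period * period)) (k % period)
          ≡⟨ iterate-+ rotate d (k / period * period) (k % period) ⟨
        iterate rotate d (k / period * period + k % period)
          ≡⟨ cong (iterate rotate d) (trans (ℕ.+-comm _ (k % period)) (sym (m≡m%n+[m/n]*n k period))) ⟩
        iterate rotate d k
          ≡⟨ ends ⟩
        e
          ∎)
        where open ≡-Reasoning

      -- In a simple graph a dart leaving `v` is determined by its target, so the positions below
      -- `period` enumerate the neighbours without repetition.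
      period≡degree : period ≡ degree (source d)
      period≡degree = ↔⇒≡ (↔-sym (Fin∣p∣↔Member (neighbours (source d))) ↔-∘ mk↔ₛ′ to from to-from from-to)
        where
        v : Fin n
        v = source d

        adj⇒member : ∀ {u} → Adj v u → T (Vec.lookup (neighbours v) u)
        adj⇒member {u} = subst T (sym (lookup∘tabulate (adj v) u))

        member⇒adj : ∀ {u} → T (Vec.lookup (neighbours v) u) → Adj v u
        member⇒adj {u} = subst T (lookup∘tabulate (adj v) u)

        to : Fin period → Member (neighbours v)
        to k = target e , adj⇒member (subst (λ w → Adj w (target e)) (iterate-source d (toℕ k)) (edge e))
          where e = iterate rotate d (toℕ k)

        position : (x : Member (neighbours v)) → ∃[ k ] k < period × iterate rotate d k ≡ dart v (proj₁ x) (member⇒adj (proj₂ x))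
        position (u , t) = index (dart v u (member⇒adj t)) refl

        from : Member (neighbours v) → Fin period
        from x = fromℕ< (proj₁ (proj₂ (position x)))

        to-from : ∀ x → to (from x) ≡ x
        to-from x = let k , k<p , eq = position x in
          member-≡ (neighbours v) (trans (cong (λ j → target (iterate rotate d j)) (toℕ-fromℕ< k<p)) (cong target eq))

        from-to : ∀ k → from (to k) ≡ k
        from-to k = let j , j<p , eq = position (to k) in
          toℕ-injective (trans (toℕ-fromℕ< j<p) (unique j<p (toℕ<n k)
            (trans eq (dart-≡ (sym (iterate-source d (toℕ k))) refl))))

    abstract
      period-of : ∀ d → Period d
      -- Starting from `rotate d` rather than `d` rules out the trivial return in zero steps.
      period-of d with rotate-cyclic (rotate d) d (rotate-source d)
      ... | k , closes with least (λ k → iterate rotate d (suc k) ≟ᵈ d) k closes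
      ...   | m , closes′ , min = record { predPeriod = m ; closes = closes′ ; minimal = min }

-- Neighbourhoods in word-representable graphs

occurrences : ∀ {n} → Fin n → List (Fin n) → ℕ → ℕ
occurrences x w       zero    = 0
occurrences x []      (suc k) = 0
occurrences x (z ∷ w) (suc k) =
  if ⌊ z ≟ x ⌋ then suc (occurrences x w k) else occurrences x w k

module _ {n : ℕ} where

  -- For distinct letters this is `AlternatesFrom x y` of the restricted word, as the next two
  -- lemmas show. Inequalities between prefix counts, unlike alternation, can be chained.
  Leads : Fin n → Fin n → List (Fin n) → Set
  Leads x y w = ∀ k → occurrences y w k ≤ occurrences x w k ×
                      occurrences x w k ≤ suc (occurrences y w k)

  alternates⇒leads : ∀ {x y} → x ≢ y → ∀ w → AlternatesFrom x y (restrict x y w) → Leads x y w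
  alternates⇒leads x≢y w       alt zero    = z≤n , z≤n
  alternates⇒leads x≢y []      alt (suc k) = z≤n , z≤n
  alternates⇒leads {x} {y} x≢y (z ∷ w) alt (suc k) with z ≟ x | z ≟ y
  alternates⇒leads x≢y (z ∷ w) alt (suc k) | yes refl | yes refl = contradiction refl x≢y
  alternates⇒leads {x} {y} x≢y (z ∷ w) (_ ∷ alt) (suc k) | yes refl | no _ =
    let x≤y , y≤1+x = alternates⇒leads (x≢y ∘ sym) w (subst (AlternatesFrom y x) (restrict-comm x y w) alt) k
    in y≤1+x , s≤s x≤y
  alternates⇒leads x≢y (z ∷ w) (z≡x ∷ _) (suc k) | no z≢x | yes _ = contradiction z≡x z≢x
  alternates⇒leads x≢y (z ∷ w) alt (suc k) | no _ | no _ = alternates⇒leads x≢y w alt k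

  leads⇒alternates : ∀ {x y} → x ≢ y → ∀ w → Leads x y w → AlternatesFrom x y (restrict x y w)
  leads⇒alternates x≢y [] _ = []
  leads⇒alternates {x} {y} x≢y (z ∷ w) leads with z ≟ x | z ≟ y | leads ∘ suc
  ... | yes refl | yes refl | _ = contradiction refl x≢y
  ... | yes refl | no _ | leads′ = refl ∷ subst (AlternatesFrom y x) (restrict-comm y x w)
    (leads⇒alternates (x≢y ∘ sym) w λ k → s≤s⁻¹ (proj₂ (leads′ k)) , proj₁ (leads′ k))
  -- A word beginning with `y` violates the bound already at its prefix of length one.
  ... | no _ | yes _ | leads′ with () ← proj₁ (leads′ 0)
  ... | no _ | no _ | leads′ = leads⇒alternates x≢y w leads′

module _ {n : ℕ} (G : Graph n) where
  open Graph G

  adj⇒≢ : ∀ {u v} → Adj u v → u ≢ v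
  adj⇒≢ uv u≡v = adj-irrefl u≡v uv

  K₄ : ∀ {a b c d} → Adj a b → Adj a c → Adj a d → Adj b c → Adj b d → Adj c d →
       ContainsInduced (complete 4) G
  K₄ {a} {b} {c} {d} ab ac ad bc bd cd = f , injective _ _ , λ i j → mk⇔ (to i j) (from i j)
    where
    f : Fin 4 → Fin n
    f 0F = a
    f 1F = b
    f 2F = c
    f 3F = d

    pairwise : ∀ i j → i ≢ j → Adj (f i) (f j)
    pairwise 0F 0F i≢j = contradiction refl i≢j
    pairwise 0F 1F _   = ab
    pairwise 0F 2F _   = ac
    pairwise 0F 3F _   = ad
    pairwise 1F 0F _   = adj-sym ab
    pairwise 1F 1F i≢j = contradiction refl i≢j
    pairwise 1F 2F _   = bc
    pairwise 1F 3F _   = bd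
    pairwise 2F 0F _   = adj-sym ac
    pairwise 2F 1F _   = adj-sym bc
    pairwise 2F 2F i≢j = contradiction refl i≢j
    pairwise 2F 3F _   = cd
    pairwise 3F 0F _   = adj-sym ad
    pairwise 3F 1F _   = adj-sym bd
    pairwise 3F 2F _   = adj-sym cd
    pairwise 3F 3F i≢j = contradiction refl i≢j

    injective : ∀ i j → f i ≡ f j → i ≡ j
    injective i j eq with i ≟ j
    ... | yes i≡j = i≡j
    ... | no  i≢j = contradiction eq (adj⇒≢ (pairwise i j i≢j))

    to : ∀ i j → Graph.Adj (complete 4) i j → Adj (f i) (f j)
    to i j ij with i ≟ j
    ... | no i≢j = pairwise i j i≢j

    from : ∀ i j → Adj (f i) (f j) → Graph.Adj (complete 4) i j
    from i j ij with i ≟ j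
    ... | yes i≡j = contradiction (cong f i≡j) (adj⇒≢ ij)
    ... | no  _   = _

  module Neighbourhood (w : List (Fin n))
                       (represents : ∀ x y → x ≢ y → Alternate x y w ⇔ Adj x y) where

    N : Fin n → ℕ → ℕ
    N x = occurrences x w

    adj⇒leads : ∀ {x y} → Adj x y → Leads x y w ⊎ Leads y x w
    adj⇒leads {x} {y} xy with Equivalence.from (represents x y (adj⇒≢ xy)) xy
    ... | inj₁ alt = inj₁ (alternates⇒leads (adj⇒≢ xy) w alt)
    ... | inj₂ alt = inj₂ (alternates⇒leads (adj⇒≢ xy ∘ sym) w
                       (subst (AlternatesFrom y x) (restrict-comm x y w) alt))

    leads⇒adj : ∀ {x y} → x ≢ y → Leads x y w → Adj x y
    leads⇒adj {x} {y} x≢y leads = Equivalence.to (represents x y x≢y) (inj₁ (leads⇒alternates x≢y w leads))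

    -- Adding one to the counts of the neighbours that v leads makes the counts
    -- of all neighbours exceed that of v by 0 or 1.
    record Shift (v x : Fin n) : Set where
      field
        shift : ℕ
        0or1  : shift ≡ 0 ⊎ shift ≡ 1
        lower : ∀ k → N v k ≤ shift + N x k
        upper : ∀ k → shift + N x k ≤ suc (N v k)

    shift-of : ∀ {v x} → Adj v x → Shift v x
    shift-of vx with adj⇒leads vx
    ... | inj₁ v-leads = record { shift = 1 ; 0or1 = inj₂ refl ; lower = proj₂ ∘ v-leads ; upper = s≤s ∘ proj₁ ∘ v-leads }
    ... | inj₂ x-leads = record { shift = 0 ; 0or1 = inj₁ refl ; lower = proj₁ ∘ x-leads ; upper = proj₂ ∘ x-leads }

    module _ {v x y : Fin n} (σ : Shift v x) (τ : Shift v y) where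
      private
        module σ = Shift σ
        module τ = Shift τ

      gap : ∀ k → τ.shift + N y k ≤ suc (σ.shift + N x k)
      gap k = ℕ.≤-trans (τ.upper k) (s≤s (σ.lower k))

      -- By `gap`, if one shifted count dominates the other, then their difference is 0 or 1
      -- throughout. Undoing the shifts decides which letter leads.
      below⇒leads : (∀ k → σ.shift + N x k ≤ τ.shift + N y k) → Leads x y w ⊎ Leads y x w
      below⇒leads below with σ.shift | τ.shift | σ.0or1 | τ.0or1 | below | gap
      ... | _ | _ | inj₁ refl | inj₁ refl | b | g = inj₂ λ k → b k , g k
      ... | _ | _ | inj₁ refl | inj₂ refl | b | g = inj₁ λ k → s≤s⁻¹ (g k) , b k
      -- All counts vanish at the empty prefix, where a shift of 1 cannot lie below a shift of 0.
      ... | _ | _ | inj₂ refl | inj₁ refl | b | g with () ← b 0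
      ... | _ | _ | inj₂ refl | inj₂ refl | b | g = inj₂ λ k → s≤s⁻¹ (b k) , s≤s⁻¹ (g k)

      -- The difference of the counts takes only the values 0 and 1. The shifts change it by a
      -- constant from -1 to 1, after which it still does not take both signs.
      leads⇒comparable : Leads x y w → (∀ k → σ.shift + N x k ≤ τ.shift + N y k) ⊎
                                       (∀ k → τ.shift + N y k ≤ σ.shift + N x k)
      leads⇒comparable leads with σ.shift | τ.shift | σ.0or1 | τ.0or1
      ... | _ | _ | inj₁ refl | inj₁ refl = inj₂ (proj₁ ∘ leads)
      ... | _ | _ | inj₁ refl | inj₂ refl = inj₁ (proj₂ ∘ leads)
      ... | _ | _ | inj₂ refl | inj₁ refl = inj₂ (ℕ.m≤n⇒m≤1+n ∘ proj₁ ∘ leads)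
      ... | _ | _ | inj₂ refl | inj₂ refl = inj₂ (s≤s ∘ proj₁ ∘ leads)

    height : Dart → ℕ → ℕ
    height d k = Shift.shift (shift-of (edge d)) + N (target d) k

    record _⊑_ (d e : Dart) : Set where
      constructor below
      field height-≤ : ∀ k → height d k ≤ height e k

    ⊑-trans : ∀ {d e f} → d ⊑ e → e ⊑ f → d ⊑ f
    ⊑-trans (below p) (below q) = below λ k → ℕ.≤-trans (p k) (q k)

    -- Together with `⊑-trans` and `⊑⇒adj`, this makes the neighbourhood of a vertex a comparability
    -- graph.
    adj⇒comparable : ∀ d e → source d ≡ source e → Adj (target d) (target e) → d ⊑ e ⊎ e ⊑ d
    adj⇒comparable (dart v x vx) (dart v y vy) refl xy with adj⇒leads xy
    ... | inj₁ leads = Sum.map below below (leads⇒comparable (shift-of vx) (shift-of vy) leads)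
    ... | inj₂ leads = Sum.swap (Sum.map below below (leads⇒comparable (shift-of vy) (shift-of vx) leads))

    ⊑⇒adj : ∀ {d e} → source d ≡ source e → target d ≢ target e → d ⊑ e → Adj (target d) (target e)
    ⊑⇒adj {dart v x vx} {dart v y vy} refl x≢y (below b) with below⇒leads (shift-of vx) (shift-of vy) b
    ... | inj₁ leads = leads⇒adj x≢y leads
    ... | inj₂ leads = adj-sym (leads⇒adj (x≢y ∘ sym) leads)

alternating⇒even : ∀ (f : ℕ → Bool) → (∀ k → f (suc k) ≡ not (f k)) → ∀ p → f p ≡ f 0 → 2 ∣ p
alternating⇒even f alt zero          _  = 2 ∣0
alternating⇒even f alt (suc zero)    eq = contradiction (sym (trans (sym (alt 0)) eq)) (not-¬ refl)
alternating⇒even f alt (suc (suc p)) eq = ∣m∣n⇒∣m+n ∣-refl (alternating⇒even f alt p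
  (trans (sym (trans (alt (suc p)) (trans (cong not (alt p)) (not-involutive (f p))))) eq))

-- Triangular faces, and even degrees from words

module NearTriangulation {n : ℕ} {G : Graph n} (P : PlaneEmbedding G)
                         (triangulated : PlaneEmbedding.IsNearTriangulation P) where
  open Graph G
  open PlaneEmbedding P
  open Rotation rotationSystem public

  nextᵈ : Dart → Dart
  nextᵈ d = rotate (rev d)

  at-injective : ∀ {d e} → at {G = G} d ≡ at e → d ≡ e
  at-injective refl = refl

  triangle : ∀ {F} → F ≢ outer → ∃[ d ] face (at d) ≡ F × nextᵈ (nextᵈ (nextᵈ d)) ≡ d ×
             (∀ e → face (at e) ≡ F → e ≡ d ⊎ e ≡ nextᵈ d ⊎ e ≡ nextᵈ (nextᵈ d))
  triangle {F} F≢outer with triangulated F F≢outer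
  ... | d , closed , boundary = d , Equivalence.from (boundary (at d)) (inj₁ refl) , at-injective closed ,
    λ e eq → Sum.map at-injective (Sum.map at-injective at-injective) (Equivalence.to (boundary (at e)) eq)

  -- `triangle` gives the closed walk from one dart of the face; each of the other two darts starts
  -- the same walk one or two steps later.
  next³ : ∀ {d} → face (at d) ≢ outer → nextᵈ (nextᵈ (nextᵈ d)) ≡ d
  next³ {d} inner with triangle inner
  ... | d₀ , _ , closed , darts with darts d refl
  ...   | inj₁ eq        rewrite eq = closed
  ...   | inj₂ (inj₁ eq) rewrite eq = cong nextᵈ closed
  ...   | inj₂ (inj₂ eq) rewrite eq = cong (nextᵈ ∘ nextᵈ) closed

  source-nextᵈ : ∀ d → source (nextᵈ d) ≡ target d
  source-nextᵈ d = rotate-source (rev d)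

  rotate-adj : ∀ e → face (at (rotate e)) ≢ outer → Adj (target e) (target (rotate e))
  rotate-adj e inner = adj-sym (subst₂ Adj (source-nextᵈ d) (begin
      target (nextᵈ d)           ≡⟨ source-nextᵈ (nextᵈ d) ⟨
      -- Since `nextᵈ` rotates after reversing, cancelling the last `rotate` in `next³` identifies
      -- the third dart of the triangle as `rev e`.
      source (nextᵈ (nextᵈ d))   ≡⟨ cong target (rotate-injective (next³ inner)) ⟩
      target e                   ∎)
    (edge (nextᵈ d)))
    where
    open ≡-Reasoning
    d : Dart
    d = rotate e

  module _ (representable : WordRepresentable G) (no-K₄ : ¬ ContainsInduced (complete 4) G) where
    open Neighbourhood G (proj₁ representable) (proj₂ representable)

    module _ {v : Fin n} (inner : Inner v) (d₀ : Dart) (at-v : source d₀ ≡ v) where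
      open Period (period-of d₀)

      neighbours-adj : ∀ d → source d ≡ v → Adj (target d) (target (rotate d))
      neighbours-adj d eq = rotate-adj d λ out → inner (at (rotate d) , trans (rotate-source d) eq , out)

      comparison : ∀ d → source d ≡ v → d ⊑ rotate d ⊎ rotate d ⊑ d
      comparison d eq = adj⇒comparable d (rotate d) (sym (rotate-source d)) (neighbours-adj d eq)

      ascends : ∀ d → source d ≡ v → Bool
      ascends d eq with comparison d eq
      ... | inj₁ _ = true
      ... | inj₂ _ = false

      -- Three consecutive neighbours already have two adjacencies; comparability of the outer two
      -- gives the third, and `v` completes a `K₄`. If `rotate (rotate d)` were `d`, the outer two
      -- would coincide.
      no-chain : ∀ d → source d ≡ v → rotate (rotate d) ≢ d →
                 ¬ (d ⊑ rotate (rotate d) ⊎ rotate (rotate d) ⊑ d)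
      no-chain d eq ≢d chain = no-K₄ (K₄ G (from-v d eq) (from-v (rotate d) eq′) (from-v (rotate (rotate d)) eq″)
        (neighbours-adj d eq) x~z (neighbours-adj (rotate d) eq′))
        where
        eq′ : source (rotate d) ≡ v
        eq′ = trans (rotate-source d) eq
        eq″ : source (rotate (rotate d)) ≡ v
        eq″ = trans (rotate-source (rotate d)) eq′

        from-v : ∀ e → source e ≡ v → Adj v (target e)
        from-v e refl = edge e

        x≢z : target d ≢ target (rotate (rotate d))
        x≢z x≡z = ≢d (dart-≡ (trans eq″ (sym eq)) (sym x≡z))

        x~z : Adj (target d) (target (rotate (rotate d)))
        x~z = [ ⊑⇒adj (trans eq (sym eq″)) x≢z
              , adj-sym ∘ ⊑⇒adj (trans eq″ (sym eq)) (x≢z ∘ sym) ]′ chain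

      ascends-alternates : ∀ d eq eq′ → rotate (rotate d) ≢ d → ascends (rotate d) eq′ ≡ not (ascends d eq)
      ascends-alternates d eq eq′ ≢d with comparison d eq | comparison (rotate d) eq′
      ... | inj₁ up   | inj₁ up′   = contradiction (inj₁ (⊑-trans up up′)) (no-chain d eq ≢d)
      ... | inj₁ _    | inj₂ _     = refl
      ... | inj₂ _    | inj₁ _     = refl
      ... | inj₂ down | inj₂ down′ = contradiction (inj₂ (⊑-trans down′ down)) (no-chain d eq ≢d)

      ascends-cong : ∀ {d e} p q → d ≡ e → ascends d p ≡ ascends e q
      ascends-cong p q refl = cong (ascends _) (Decidable⇒UIP.≡-irrelevant _≟_ p q)

      walk : ℕ → Dart
      walk = iterate rotate d₀

      walk-source : ∀ k → source (walk k) ≡ v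
      walk-source k = trans (iterate-source d₀ k) at-v

      source-step : ∀ k → source (rotate (walk k)) ≡ v
      source-step k = trans (rotate-source (walk k)) (walk-source k)

      period-even : 2 ∣ period
      period-even with rotate (rotate d₀) ≟ᵈ d₀
      ... | no ¬returns = alternating⇒even (λ k → ascends (walk k) (walk-source k))
        (λ k → trans (ascends-cong (walk-source (suc k)) (source-step k) (iterate-suc rotate d₀ k))
          (ascends-alternates (walk k) (walk-source k) (source-step k) λ eq → ¬returns
            (iterate-injective rotate rotate-injective k
              (trans (trans (iterate-suc rotate (rotate d₀) k) (cong rotate (iterate-suc rotate d₀ k))) eq))))
        period
        (ascends-cong (walk-source period) (walk-source 0) closes)
      -- A return after two steps leaves only periods one and two, and period one would make a
      -- neighbour adjacent to itself.
      ... | yes returns with predPeriod | closes | minimal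
      ...   | 0           | closes₁ | _   = contradiction (cong target (sym closes₁)) (adj⇒≢ G (neighbours-adj d₀ at-v))
      ...   | 1           | _       | _   = ∣-refl
      ...   | suc (suc _) | _       | min = contradiction returns (min (s≤s z<s))

    representable⇒even : InternallyEven
    representable⇒even v inner with degree v ℕ.≟ 0
    ... | yes deg≡0 = subst (2 ∣_) (sym deg≡0) (2 ∣0)
    ... | no  deg≢0 with degree≢0⇒dart deg≢0
    ...   | d₀ , refl = subst (2 ∣_) (Period.period≡degree (period-of d₀)) (period-even inner d₀ refl)

-- Cohomology of the bounded faces

bounded : ∀ {n} (f : Fin n → ℕ) → ∃[ b ] (∀ i → f i ≤ b)
bounded {zero}  f = 0 , λ ()
bounded {suc n} f with bounded (f ∘ suc)
... | b , f≤b = f zero ⊔ b , λ where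
  zero    → ℕ.m≤m⊔n (f zero) b
  (suc i) → ℕ.≤-trans (f≤b i) (ℕ.m≤n⊔m (f zero) b)

injective⇒surjective : ∀ {k} (f : Fin k → Fin k) → Injective _≡_ _≡_ f → ∀ y → ∃[ x ] f x ≡ y
injective⇒surjective {suc k} f inj y with any? (λ x → f x ≟ y)
... | yes hit = hit
... | no miss = contradiction
  (λ {i} {j} eq → inj (punchOut-injective (avoids i) (avoids j) eq))
  (<⇒notInjective {f = λ x → punchOut (avoids x)} ℕ.≤-refl)
  where
  avoids : ∀ x → y ≢ f x
  avoids x y≡fx = miss (x , sym y≡fx)

funToFin-cong : ∀ {m n} {f g : Fin m → Fin n} → f ≗ g → funToFin f ≡ funToFin g
funToFin-cong {zero}  eq = refl
funToFin-cong {suc m} eq = cong₂ Fin.combine (eq zero) (funToFin-cong (eq ∘ suc))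

module _ {m N : ℕ} {A : Set} (finite : A ↔ Fin m) where
  open Inverse finite

  private
    decode : Fin (m ^ N) → Fin N → A
    decode i = from ∘ finToFun i

    encode : (Fin N → A) → Fin (m ^ N)
    encode g = funToFin (to ∘ g)

    decode-encode : ∀ g → decode (encode g) ≗ g
    decode-encode g i = trans (cong from (finToFun-funToFin (to ∘ g) i)) (strictlyInverseʳ (g i))

    encode-decode : ∀ i → encode (decode i) ≡ i
    encode-decode i = trans (funToFin-cong (strictlyInverseˡ ∘ finToFun {m} {N} i)) (funToFin-finToFin {N} {m} i)

  -- The maps `Fin N → A`, taken up to `≗`, are coded by `Fin (m ^ N)`. Counting elements takes the
  -- place of counting dimensions, so any finite group can serve as coefficients.
  injective⇒surjective-→ : (Φ : (Fin N → A) → (Fin N → A)) →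
    (∀ g g′ → Φ g ≗ Φ g′ → g ≗ g′) → ∀ h → ∃[ g ] Φ g ≗ h
  injective⇒surjective-→ Φ inj h
    with injective⇒surjective (encode ∘ Φ ∘ decode) ψ-injective (encode h)
    where
    ψ-injective : Injective _≡_ _≡_ (encode ∘ Φ ∘ decode)
    ψ-injective {i} {j} eq = trans (sym (encode-decode i)) (trans
      (funToFin-cong (λ k → cong to (inj (decode i) (decode j) (λ l → trans (sym (decode-encode _ l))
        (trans (cong (λ x → decode x l) eq) (decode-encode _ l))) k)))
      (encode-decode j))
  ... | i , eq = decode i , λ k → trans (sym (decode-encode _ k))
                   (trans (cong (λ x → decode x k) eq) (decode-encode h k))

-- A spanning tree of the dual graph

module DualTree {n : ℕ} {G : Graph n} (P : PlaneEmbedding G) where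
  open Graph G
  open PlaneEmbedding P
  

  rev-involutive : ∀ d → rev (rev d) ≡ d
  rev-involutive d = dart-≡ refl refl

  faceᵈ : Dart → Fin #faces
  faceᵈ d = face (at d)

  face-rotate : ∀ d → faceᵈ (rotate d) ≡ faceᵈ (rev d)
  face-rotate d = trans (cong (faceᵈ ∘ rotate) (sym (rev-involutive d))) (face-next (at (rev d)))

  -- Walks of length `k` to the outer face in the dual graph, each step crossing the edge of a dart.
  Within : ℕ → Fin #faces → Set
  Within zero    F = F ≡ outer
  Within (suc k) F = ∃[ d ] faceᵈ d ≡ F × Within k (faceᵈ (rev d))

  within? : ∀ k → Decidable (Within k)
  within? zero    F = F ≟ outer
  within? (suc k) F = any-dart? λ d → (faceᵈ d ≟ F) ×-dec within? k (faceᵈ (rev d))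

  Reaches : Fin #faces → Set
  Reaches F = ∃[ k ] Within k F

  reaches-rev : ∀ d → Reaches (faceᵈ d) → Reaches (faceᵈ (rev d))
  reaches-rev d (k , within) = suc k , rev d , refl ,
    subst (Within k ∘ faceᵈ) (sym (rev-involutive d)) within

  reaches-iterate : ∀ d k → Reaches (faceᵈ d) → Reaches (faceᵈ (iterate rotate d k))
  reaches-iterate d zero    r = r
  reaches-iterate d (suc k) r =
    reaches-iterate (rotate d) k (subst Reaches (sym (face-rotate d)) (reaches-rev d r))

  reaches-vertex : ∀ c c′ → vertex c ≡ vertex c′ → Reaches (face c) → Reaches (face c′)
  reaches-vertex (at d) (at e) eq r with rotate-cyclic d e eq
  ... | k , refl = reaches-iterate d k r
  reaches-vertex (at d) (isolated _ p) refl r = ⊥-elim (dart⇒degree≢0 d p)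
  reaches-vertex (isolated _ p) (at d) refl r = ⊥-elim (dart⇒degree≢0 d p)
  reaches-vertex (isolated v p) (isolated v q) refl r =
    subst (λ q → Reaches (face (isolated v q))) (ℕ.≡-irrelevant p q) r

  reaches-adj : ∀ {u v} → Adj u v → (∀ c → vertex c ≡ u → Reaches (face c)) →
                ∀ c → vertex c ≡ v → Reaches (face c)
  reaches-adj uv reach-u c eq =
    reaches-vertex (at (rev (dart _ _ uv))) c (sym eq) (reaches-rev _ (reach-u (at (dart _ _ uv)) refl))

  -- Rotating about a vertex crosses one edge at a time, so one reaching corner makes all corners
  -- there reach. Hence the property passes along `Touch` in both directions.
  Reachable : Fin n ⊎ Fin #faces → Set
  Reachable (inj₁ v) = ∀ c → vertex c ≡ v → Reaches (face c)
  Reachable (inj₂ F) = Reaches F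

  reachable-touch : ∀ {x y} → Touch G face x y → Reachable x → Reachable y
  reachable-touch (adjacent uv) r = reaches-adj uv r
  reachable-touch (corner c)    r = r c refl

  reachable-touch⁻¹ : ∀ {x y} → Touch G face x y → Reachable y → Reachable x
  reachable-touch⁻¹ (adjacent uv) r = reaches-adj (adj-sym uv) r
  reachable-touch⁻¹ (corner c)    r c′ eq = reaches-vertex c c′ (sym eq) r

  reaches : ∀ F → Reaches F
  reaches F = go (connected (inj₂ outer) (inj₂ F)) (0 , refl)
    where
    go : ∀ {x y} → EqClosure (Touch G face) x y → Reachable x → Reachable y
    go ε r = r
    go (fwd t ◅ ts) r = go ts (reachable-touch t r)
    go (bwd t ◅ ts) r = go ts (reachable-touch⁻¹ t r)

  depth-least : ∀ F → ∃[ k ] Within k F × (∀ {j} → j < k → ¬ Within j F)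
  depth-least F = let k , within = reaches F in least (λ k → within? k F) k within

  depth : Fin #faces → ℕ
  depth F = proj₁ (depth-least F)

  -- The dart is the first step of a shortest walk to the outer face.
  closer : ∀ F → F ≢ outer → ∃[ d ] faceᵈ d ≡ F × depth (faceᵈ (rev d)) < depth F
  closer F F≢outer with depth-least F
  ... | zero  , F≡outer , _ = contradiction F≡outer F≢outer
  ... | suc k , (d , eq , within) , _ = d , eq ,
    s≤s (ℕ.≮⇒≥ λ k< → proj₂ (proj₂ (depth-least (faceᵈ (rev d)))) k< within)

  -- The edges chosen here form a spanning tree of the dual graph, rooted at the outer face.
  parent : Fin #faces → Maybe Dart
  parent F with F ≟ outer
  ... | yes _ = nothing
  ... | no F≢outer = just (proj₁ (closer F F≢outer))

  parent-closer : ∀ {F d} → parent F ≡ just d → faceᵈ d ≡ F × depth (faceᵈ (rev d)) < depth F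
  parent-closer {F} eq with F ≟ outer
  parent-closer {F} refl | no F≢outer = proj₂ (closer F F≢outer)

  parent-inner : ∀ {F d} → parent F ≡ just d → F ≢ outer
  parent-inner {F} eq with F ≟ outer
  parent-inner () | yes _
  ... | no F≢outer = F≢outer

  inner⇒parent : ∀ {F} → F ≢ outer → ∃[ d ] parent F ≡ just d
  inner⇒parent {F} F≢outer with F ≟ outer
  ... | yes F≡outer = contradiction F≡outer F≢outer
  ... | no  _       = _ , refl

  IsParent : Dart → Set
  IsParent d = parent (faceᵈ d) ≡ just d

  isParent? : Decidable IsParent
  isParent? d = Maybe.≡-dec _≟ᵈ_ (parent (faceᵈ d)) (just d)

  isParent-unique : ∀ {d e} → IsParent d → IsParent e → faceᵈ d ≡ faceᵈ e → d ≡ e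
  isParent-unique p q eq = just-injective (trans (sym p) (trans (cong parent eq) q))

  inner⇒isParent : ∀ {F} → F ≢ outer → ∃[ d ] faceᵈ d ≡ F × IsParent d
  inner⇒isParent F≢outer = let d , p = inner⇒parent F≢outer
                               eq = proj₁ (parent-closer p)
                           in d , eq , trans (cong parent eq) p

  isParent-descends : ∀ {d} → IsParent d → depth (faceᵈ (rev d)) < depth (faceᵈ d)
  isParent-descends p = proj₂ (parent-closer p)

  -- If an edge were chosen from both sides, each of its faces would be less deep than the other. So
  -- different bounded faces choose different edges.
  isParent-asym : ∀ {d} → IsParent d → ¬ IsParent (rev d)
  isParent-asym {d} p q = ℕ.<-asym (isParent-descends p)
    (subst (λ e → depth (faceᵈ e) < depth (faceᵈ (rev d))) (rev-involutive d) (isParent-descends q))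

module Edges {n : ℕ} (G : Graph n) where
  open Graph G

  private
    edge? : Decidable (λ (p : Fin n × Fin n) → proj₁ p Fin.< proj₂ p × Adj (proj₁ p) (proj₂ p))
    edge? (u , v) = (u Fin.<? v) ×-dec T? (adj u v)

  abstract
    edgeDart : Fin (length edges) → Dart
    edgeDart i = dart _ _ (proj₂ (proj₂ (∈-filter⁻ edge? {xs = cartesianProduct (allFin n) (allFin n)}
                   (∈-lookup {xs = edges} i))))

    source<target : ∀ d → source d Fin.< target d → ∃[ i ] edgeDart i ≡ d
    source<target d s<t = Any.index d∈ , dart-≡ (cong proj₁ (sym eq)) (cong proj₂ (sym eq))
      where
      d∈ : (source d , target d) ∈ edges
      d∈ = ∈-filter⁺ edge? (∈-cartesianProduct⁺ (∈-allFin (source d)) (∈-allFin (target d))) (s<t , edge d)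
      eq : (source d , target d) ≡ List.lookup edges (Any.index d∈)
      eq = lookup-index d∈

  edgeDart-complete : ∀ d → ∃[ i ] (edgeDart i ≡ d ⊎ edgeDart i ≡ rev d)
  edgeDart-complete d with Fin.<-cmp (source d) (target d)
  ... | tri< s<t _ _ = let i , eq = source<target d s<t in i , inj₁ eq
  ... | tri≈ _ s≡t _ = contradiction s≡t (source≢target d)
  ... | tri> _ _ t<s = let i , eq = source<target (rev d) t<s in i , inj₂ eq

-- Potentials for cocycles

module Cohomology {n : ℕ} {G : Graph n} (P : PlaneEmbedding G)
                  (triangulated : PlaneEmbedding.IsNearTriangulation P)
                  {m : ℕ} {A : Set} (finite : A ↔ Fin m)
                  {_∙_ : A → A → A} {0# : A} {neg : A → A} (isGroup : IsGroup _≡_ _∙_ 0# neg) where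
  open Graph G
  open PlaneEmbedding P
  open NearTriangulation P triangulated
  open DualTree P
  open Edges G
  open IsGroup isGroup using (assoc; identityˡ; inverseˡ; inverseʳ)

  private
    group : Group _ _
    group = record { isGroup = isGroup }

  open GroupProperties group using (∙-cancelˡ; ∙-cancelʳ; ⁻¹-anti-homo-∙; ⁻¹-involutive; ⁻¹-injective)

  -- A 1-cocycle on the complex of vertices, edges and bounded faces; the order of the factors
  -- matters in a non-commutative group.
  record Cocycle (c : Dart → A) : Set where
    field
      antisymmetric : ∀ d → c (rev d) ≡ neg (c d)
      closed        : ∀ d → faceᵈ d ≢ outer → c d ∙ (c (nextᵈ d) ∙ c (nextᵈ (nextᵈ d))) ≡ 0#

  δ : (Fin n → A) → Dart → A
  δ f d = neg (f (source d)) ∙ f (target d)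

  telescope : ∀ x y z → (neg x ∙ y) ∙ (neg y ∙ z) ≡ neg x ∙ z
  telescope x y z = begin
    (neg x ∙ y) ∙ (neg y ∙ z) ≡⟨ assoc (neg x) y _ ⟩
    neg x ∙ (y ∙ (neg y ∙ z)) ≡⟨ cong (neg x ∙_) (assoc y (neg y) z) ⟨
    neg x ∙ ((y ∙ neg y) ∙ z) ≡⟨ cong (λ w → neg x ∙ (w ∙ z)) (inverseʳ y) ⟩
    neg x ∙ (0# ∙ z)          ≡⟨ cong (neg x ∙_) (identityˡ z) ⟩
    neg x ∙ z                 ∎
    where open ≡-Reasoning

  δ-cocycle : ∀ f → Cocycle (δ f)
  δ-cocycle f = record { antisymmetric = antisymmetric ; closed = closed }
    where
    antisymmetric : ∀ d → δ f (rev d) ≡ neg (δ f d)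
    antisymmetric d = sym (trans (⁻¹-anti-homo-∙ _ _) (cong (neg (f (target d)) ∙_) (⁻¹-involutive _)))

    closed : ∀ d → faceᵈ d ≢ outer → δ f d ∙ (δ f (nextᵈ d) ∙ δ f (nextᵈ (nextᵈ d))) ≡ 0#
    closed d inner = begin
      δ f d ∙ (δ f d₁ ∙ δ f d₂)
        ≡⟨ cong₂ (λ y z → δ f d ∙ ((neg y ∙ f (target d₁)) ∙ (neg z ∙ f (target d₂))))
             (cong f (source-nextᵈ d)) (cong f (source-nextᵈ d₁)) ⟩
      δ f d ∙ ((neg (f (target d)) ∙ f (target d₁)) ∙ (neg (f (target d₁)) ∙ f (target d₂)))
        ≡⟨ cong (δ f d ∙_) (telescope _ _ _) ⟩
      δ f d ∙ (neg (f (target d)) ∙ f (target d₂))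
        ≡⟨ telescope _ _ _ ⟩
      neg (f (source d)) ∙ f (target d₂)
        ≡⟨ cong (λ v → neg (f (source d)) ∙ f v) (trans (sym (source-nextᵈ d₂)) (cong source (next³ inner))) ⟩
      neg (f (source d)) ∙ f (source d)
        ≡⟨ inverseˡ _ ⟩
      0# ∎
      where
      open ≡-Reasoning
      d₁ d₂ : Dart
      d₁ = nextᵈ d
      d₂ = nextᵈ d₁

  module _ {c c′ : Dart → A} (κ : Cocycle c) (κ′ : Cocycle c′) where
    private
      module κ = Cocycle κ
      module κ′ = Cocycle κ′

    agree-rev : ∀ {d} → c (rev d) ≡ c′ (rev d) → c d ≡ c′ d
    agree-rev {d} eq = ⁻¹-injective (trans (sym (κ.antisymmetric d)) (trans eq (κ′.antisymmetric d)))

    agree-triangle : ∀ {d} → faceᵈ d ≢ outer → c (nextᵈ d) ≡ c′ (nextᵈ d) →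
                     c (nextᵈ (nextᵈ d)) ≡ c′ (nextᵈ (nextᵈ d)) → c d ≡ c′ d
    agree-triangle {d} inner eq₁ eq₂ = ∙-cancelʳ _ _ _
      (trans (κ.closed d inner) (trans (sym (κ′.closed d inner)) (cong (c′ d ∙_) (sym (cong₂ _∙_ eq₁ eq₂)))))

    module _ (agree : ∀ d → ¬ IsParent d → ¬ IsParent (rev d) → c d ≡ c′ d) where
      private
        bound : ℕ
        bound = proj₁ (bounded depth)

        depth≤bound : ∀ F → depth F ≤ bound
        depth≤bound = proj₂ (bounded depth)

      -- Along the dual tree, from the leaves to the root.
      agree-parent : ∀ j {d} → IsParent d → bound ≤ depth (faceᵈ d) + j → c d ≡ c′ d
      agree-parent j {d} p deep = agree-triangle inner
        (other j (nextᵈ d) (face-next (at d)) next≢ deep)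
        (other j (nextᵈ (nextᵈ d)) (trans (face-next (at (nextᵈ d))) (face-next (at d))) next²≢ deep)
        where
        inner : faceᵈ d ≢ outer
        inner = parent-inner p

        next≢ : nextᵈ d ≢ d
        next≢ eq = source≢target d (trans (cong source (sym eq)) (source-nextᵈ d))

        next²≢ : nextᵈ (nextᵈ d) ≢ d
        next²≢ eq = next≢ (trans (cong nextᵈ (sym eq)) (next³ inner))

        -- Any other dart of the face is either off the tree or the reverse of the parent dart of a
        -- deeper face. The number `j` bounds the remaining descent.
        other : ∀ j e → faceᵈ e ≡ faceᵈ d → e ≢ d → bound ≤ depth (faceᵈ d) + j → c e ≡ c′ e
        other j e eq e≢d deep with isParent? e | isParent? (rev e)
        ... | yes q | _    = contradiction (isParent-unique q p eq) e≢d
        ... | no ¬q | no ¬r = agree e ¬q ¬r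
        ... | no ¬q | yes r = agree-rev (deeper j deep)
          where
          descends : depth (faceᵈ d) < depth (faceᵈ (rev e))
          descends = subst (_< depth (faceᵈ (rev e)))
            (cong depth (trans (cong faceᵈ (rev-involutive e)) eq)) (isParent-descends r)

          deeper : ∀ j → bound ≤ depth (faceᵈ d) + j → c (rev e) ≡ c′ (rev e)
          -- Here the face of `d` has maximal depth, so no face can be deeper.
          deeper zero deep = contradiction
            (ℕ.≤-trans descends (ℕ.≤-trans (depth≤bound _) deep))
            (ℕ.<⇒≱ (s≤s (ℕ.≤-reflexive (ℕ.+-identityʳ _))))
          deeper (suc j) deep = agree-parent j r (ℕ.≤-trans deep
            (ℕ.≤-trans (ℕ.≤-reflexive (ℕ.+-suc _ j)) (ℕ.+-monoˡ-≤ j descends)))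

      agree-everywhere : ∀ d → c d ≡ c′ d
      agree-everywhere d with isParent? d | isParent? (rev d)
      ... | yes p | _     = agree-parent bound p (ℕ.m≤n+m bound _)
      ... | no _  | yes q = agree-rev (agree-parent bound q (ℕ.m≤n+m bound _))
      ... | no ¬p | no ¬q = agree d ¬p ¬q

  representative : Fin #components → Fin n
  representative C = proj₁ (component-surjective C)

  δ-injective : ∀ {f f′} → (∀ d → δ f d ≡ δ f′ d) →
                (∀ C → f (representative C) ≡ f′ (representative C)) → f ≗ f′
  δ-injective {f} {f′} δ≡ base v = propagate
    (Equivalence.to (component-connected (representative (component v)) v) (proj₂ (component-surjective (component v)) refl))
    (base (component v))
    where
    propagate : ∀ {u v} → Star Adj u v → f u ≡ f′ u → f v ≡ f′ v
    propagate ε eq = eq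
    propagate {u} (uv ◅ path) eq = propagate path (∙-cancelˡ _ _ _
      (trans (δ≡ (dart _ _ uv)) (cong (λ x → neg x ∙ f′ _) (sym eq))))

  -- A potential on the vertices, overwritten by independent values on the
  -- edges of the dual tree.  Euler's formula says that there are as many
  -- unknowns as values, so that injectivity entails surjectivity.
  module _ (f : Fin n → A) (a : Fin #faces → A) where

    edgeValue : Dart → A
    edgeValue d with isParent? d | isParent? (rev d)
    ... | yes _ | _     = a (faceᵈ d)
    ... | no _  | yes _ = a (faceᵈ (rev d))
    ... | no _  | no _  = δ f d

    edgeValue-parent : ∀ {d} → IsParent d → edgeValue d ≡ a (faceᵈ d)
    edgeValue-parent {d} p with isParent? d
    ... | yes _ = refl
    ... | no ¬p = contradiction p ¬p

    edgeValue-rev : ∀ {d} → IsParent d → edgeValue (rev d) ≡ a (faceᵈ d)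
    edgeValue-rev {d} p with isParent? (rev d) | isParent? (rev (rev d))
    ... | yes q | _     = contradiction q (isParent-asym p)
    ... | no _  | yes _ = cong (a ∘ faceᵈ) (rev-involutive d)
    ... | no _  | no ¬p = contradiction (subst IsParent (sym (rev-involutive d)) p) ¬p

    edgeValue-δ : ∀ {d} → ¬ IsParent d → ¬ IsParent (rev d) → edgeValue d ≡ δ f d
    edgeValue-δ {d} ¬p ¬q with isParent? d | isParent? (rev d)
    ... | yes p | _     = contradiction p ¬p
    ... | no _  | yes q = contradiction q ¬q
    ... | no _  | no _  = refl

    -- The outer face chooses no edge, so its label gets a coordinate of its own. The
    -- representatives fix the constant that `δ` forgets on each component.
    values : Fin (length edges + (1 + #components)) → A
    values i = [ edgeValue ∘ edgeDart
               , [ const (a outer) , f ∘ representative ]′ ∘ splitAt 1 ]′ (splitAt (length edges) i)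

    values-edge : ∀ i → values (i ↑ˡ _) ≡ edgeValue (edgeDart i)
    values-edge i = cong [ _ , _ ]′ (splitAt-↑ˡ (length edges) i _)

    values-outer : values (length edges ↑ʳ zero) ≡ a outer
    values-outer = cong [ _ , _ ]′ (splitAt-↑ʳ (length edges) (1 + #components) zero)

    values-representative : ∀ C → values (length edges ↑ʳ suc C) ≡ f (representative C)
    values-representative C = cong [ _ , _ ]′ (splitAt-↑ʳ (length edges) (1 + #components) (suc C))

  ¬isParent-rev² : ∀ {d} → ¬ IsParent d → ¬ IsParent (rev (rev d))
  ¬isParent-rev² {d} = subst (¬_ ∘ IsParent) (sym (rev-involutive d))

  module _ {c c′ e e′ : Dart → A} (κ : Cocycle c) (κ′ : Cocycle c′)
           (e≡c : ∀ {d} → ¬ IsParent d → ¬ IsParent (rev d) → e d ≡ c d)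
           (e′≡c′ : ∀ {d} → ¬ IsParent d → ¬ IsParent (rev d) → e′ d ≡ c′ d)
           (e≡e′ : ∀ i → e (edgeDart i) ≡ e′ (edgeDart i)) where

    -- Off the dual tree the edge values are those of the cocycles, up to reversing the dart, and
    -- `agree-everywhere` extends the equality to the tree. The second cocycle is a coboundary when
    -- injectivity is proved and arbitrary in `cocycle⇒coboundary`.
    agree-on-edges : ∀ d → c d ≡ c′ d
    agree-on-edges = agree-everywhere κ κ′ λ d ¬p ¬q → off-tree d ¬p ¬q (edgeDart-complete d)
      where
      via : ∀ {d} → ¬ IsParent d → ¬ IsParent (rev d) → e d ≡ e′ d → c d ≡ c′ d
      via ¬p ¬q eq = trans (sym (e≡c ¬p ¬q)) (trans eq (e′≡c′ ¬p ¬q))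

      off-tree : ∀ d → ¬ IsParent d → ¬ IsParent (rev d) →
                 ∃[ i ] (edgeDart i ≡ d ⊎ edgeDart i ≡ rev d) → c d ≡ c′ d
      off-tree d ¬p ¬q (i , inj₁ eq) = via ¬p ¬q (subst (λ d → e d ≡ e′ d) eq (e≡e′ i))
      off-tree d ¬p ¬q (i , inj₂ eq) = agree-rev κ κ′
        (via ¬q (¬isParent-rev² ¬p) (subst (λ d → e d ≡ e′ d) eq (e≡e′ i)))

  -- The edges off the tree determine `δ f`, and the representatives then determine `f`. The labels
  -- `a` are read off the tree edges and the outer coordinate.
  values-injective : ∀ {f a f′ a′} → values f a ≗ values f′ a′ → f ≗ f′ × a ≗ a′
  values-injective {f} {a} {f′} {a′} eq = f≗f′ , a≗a′
    where
    edgeValues : ∀ i → edgeValue f a (edgeDart i) ≡ edgeValue f′ a′ (edgeDart i)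
    edgeValues i = trans (sym (values-edge f a i)) (trans (eq _) (values-edge f′ a′ i))

    f≗f′ : f ≗ f′
    f≗f′ = δ-injective
      (agree-on-edges (δ-cocycle f) (δ-cocycle f′) (edgeValue-δ f a) (edgeValue-δ f′ a′) edgeValues)
      λ C → trans (sym (values-representative f a C)) (trans (eq _) (values-representative f′ a′ C))

    a≗a′ : a ≗ a′
    a≗a′ F with F ≟ outer
    ... | yes refl = trans (sym (values-outer f a)) (trans (eq _) (values-outer f′ a′))
    ... | no F≢outer with inner⇒isParent F≢outer
    ...   | d , refl , p with edgeDart-complete d
    ...     | i , inj₁ is-d   = trans (sym (edgeValue-parent f a p)) (trans
      (subst (λ d → edgeValue f a d ≡ edgeValue f′ a′ d) is-d (edgeValues i)) (edgeValue-parent f′ a′ p))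
    ...     | i , inj₂ is-rev = trans (sym (edgeValue-rev f a p)) (trans
      (subst (λ d → edgeValue f a d ≡ edgeValue f′ a′ d) is-rev (edgeValues i)) (edgeValue-rev f′ a′ p))

  values-surjective : ∀ h → ∃[ f ] ∃[ a ] values f a ≗ h
  values-surjective h = let g , eq = injective⇒surjective-→ finite Φ Φ-injective (h ∘ Fin.cast euler) in
    potential g , label g , λ i → trans (cong (values _ _) (sym (Fin.cast-involutive euler (sym euler) i)))
      (trans (eq (Fin.cast (sym euler) i)) (cong h (Fin.cast-involutive euler (sym euler) i)))
    where
    potential : (Fin (n + #faces) → A) → Fin n → A
    potential g v = g (v ↑ˡ #faces)

    label : (Fin (n + #faces) → A) → Fin #faces → A
    label g F = g (n ↑ʳ F)

    Φ : (Fin (n + #faces) → A) → Fin (n + #faces) → A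
    Φ g = values (potential g) (label g) ∘ Fin.cast euler

    Φ-injective : ∀ g g′ → Φ g ≗ Φ g′ → g ≗ g′
    Φ-injective g g′ eq i with values-injective {potential g} {label g} {potential g′} {label g′}
      (λ j → subst (λ k → values (potential g) (label g) k ≡ values (potential g′) (label g′) k)
               (Fin.cast-involutive euler (sym euler) j) (eq (Fin.cast (sym euler) j)))
    ... | f≗f′ , a≗a′ with splitAt n i | join-splitAt n #faces i
    ...   | inj₁ v | refl = f≗f′ v
    ...   | inj₂ F | refl = a≗a′ F

  -- Surjectivity supplies `f` and `a` whose edge values are those of `c`. On tree edges `a` absorbs
  -- them, so they constrain `f` only off the tree, which suffices to make `δ f` equal to `c`.
  cocycle⇒coboundary : ∀ {c} → Cocycle c → ∃[ f ] (∀ d → δ f d ≡ c d)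
  cocycle⇒coboundary {c} κ = let f , a , eq = values-surjective target-values in
    f , agree-on-edges (δ-cocycle f) κ (edgeValue-δ f a) (λ _ _ → refl)
      (λ i → trans (sym (values-edge f a i)) (trans (eq (i ↑ˡ _)) (target-edge i)))
    where
    target-values : Fin (length edges + (1 + #components)) → A
    -- The coordinates of the outer face and the representatives are free; `0#` is an arbitrary
    -- choice.
    target-values i = [ c ∘ edgeDart , const 0# ]′ (splitAt (length edges) i)

    target-edge : ∀ i → target-values (i ↑ˡ _) ≡ c (edgeDart i)
    target-edge i = cong [ c ∘ edgeDart , const 0# ]′ (splitAt-↑ˡ (length edges) i _)

-- Colouring internally even near-triangulations

odd : ℕ → Bool
odd zero    = false
odd (suc k) = not (odd k)

2∣⇒odd≡false : ∀ {k} → 2 ∣ k → odd k ≡ false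
2∣⇒odd≡false (divides q refl) = go q
  where
  go : ∀ q → odd (q * 2) ≡ false
  go zero    = refl
  go (suc q) = trans (not-involutive _) (go q)

xor-isGroup : IsGroup _≡_ _xor_ false id
xor-isGroup = record
  { isMonoid = record
    { isSemigroup = record
      { isMagma = record { isEquivalence = isEquivalence ; ∙-cong = cong₂ _xor_ }
      ; assoc   = xor-assoc
      }
    ; identity = xor-identity
    }
  ; inverse = xor-same , xor-same
  ; ⁻¹-cong = id
  }

_+₃_ : Fin 3 → Fin 3 → Fin 3
i +₃ j = (toℕ i + toℕ j) mod 3

-₃_ : Fin 3 → Fin 3
-₃ i = (3 ∸ toℕ i) mod 3

+₃-isGroup : IsGroup _≡_ _+₃_ 0F -₃_
+₃-isGroup = record
  { isMonoid = record
    { isSemigroup = record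
      { isMagma = record { isEquivalence = isEquivalence ; ∙-cong = cong₂ _+₃_ }
      ; assoc   = from-yes (all? λ i → all? λ j → all? λ k → ((i +₃ j) +₃ k) ≟ (i +₃ (j +₃ k)))
      }
    ; identity = from-yes (all? λ i → (0F +₃ i) ≟ i) , from-yes (all? λ i → (i +₃ 0F) ≟ i)
    }
  ; inverse = from-yes (all? λ i → ((-₃ i) +₃ i) ≟ 0F) , from-yes (all? λ i → (i +₃ (-₃ i)) ≟ 0F)
  ; ⁻¹-cong = cong -₃_
  }

sign : Bool → Fin 3
sign true  = 1F
sign false = 2F

sign-not : ∀ b → sign (not b) ≡ -₃ sign b
sign-not true  = refl
sign-not false = refl

sign-triple : ∀ b → sign b +₃ (sign b +₃ sign b) ≡ 0F
sign-triple true  = refl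
sign-triple false = refl

sign≢0 : ∀ b → sign b ≢ 0F
sign≢0 true  ()
sign≢0 false ()

-- `not (a xor not b)` is `a xor b`, so each of the three variables is added twice.
triple-xor : ∀ a b c → not (a xor not b) xor (not (b xor not c) xor not (c xor not a)) ≡ false
triple-xor true  true  true  = refl
triple-xor true  true  false = refl
triple-xor true  false true  = refl
triple-xor true  false false = refl
triple-xor false true  true  = refl
triple-xor false true  false = refl
triple-xor false false true  = refl
triple-xor false false false = refl

-- Add `b xor s` to both sides. With `a`, `b` the parities of a dart and its reverse and `s`, `t`
-- the twists at its ends, a potential for the defect becomes a choice of opposite directions.
xor-transpose : ∀ a b s t → s xor t ≡ not (a xor b) → b xor t ≡ not (a xor s)
xor-transpose a b s t eq = begin
  b xor t                   ≡⟨ cong (b xor_) t≡ ⟩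
  b xor (s xor not (a xor b)) ≡⟨ regroup a b s ⟩
  not (a xor s)             ∎
  where
  open ≡-Reasoning

  t≡ : t ≡ s xor not (a xor b)
  t≡ = begin
    t               ≡⟨ cong (_xor t) (xor-same s) ⟨
    (s xor s) xor t ≡⟨ xor-assoc s s t ⟩
    s xor (s xor t) ≡⟨ cong (s xor_) eq ⟩
    s xor not (a xor b) ∎

  regroup : ∀ a b s → b xor (s xor not (a xor b)) ≡ not (a xor s)
  regroup true  true  true  = refl
  regroup true  true  false = refl
  regroup true  false true  = refl
  regroup true  false false = refl
  regroup false true  true  = refl
  regroup false true  false = refl
  regroup false false true  = refl
  regroup false false false = refl

module Colouring {n : ℕ} {G : Graph n} (P : PlaneEmbedding G)
                 (triangulated : PlaneEmbedding.IsNearTriangulation P)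
                 (even : PlaneEmbedding.InternallyEven P) where
  open Graph G
  open PlaneEmbedding P
  open NearTriangulation P triangulated
  open DualTree P

  -- The corner `at r` is swept by the rotation into `r`, so a root on the outer face confines the
  -- restart of the count to an outer corner.
  Root : Fin n → Dart → Set
  Root v r = source r ≡ v × (faceᵈ r ≡ outer ⊎ Inner v)

  root-at : ∀ v → ∃ (Root v) ⊎ (∀ d → source d ≢ v)
  root-at v with any-dart? (λ d → (source d ≟ v) ×-dec (faceᵈ d ≟ outer))
  ... | yes (r , at-v , out) = inj₁ (r , at-v , inj₁ out)
  ... | no no-outer with any-dart? (λ d → source d ≟ v)
  ...   | no  none       = inj₂ λ d at-v → none (d , at-v)
  ...   | yes (r , refl) = inj₁ (r , refl , inj₂ inner)
    where
    inner : Inner (source r)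
    inner (at d , at-v , out)         = no-outer (d , at-v , out)
    inner (isolated _ p , refl , out) = dart⇒degree≢0 r p

  -- Counting from a root dart, the parity of the position alternates around a
  -- vertex, except possibly where the count restarts: at the outer face, or at
  -- an inner vertex, whose degree is even.
  module _ {v : Fin n} {r : Dart} (is-root : Root v r) where
    open Period (period-of r)

    position : ∀ d → source d ≡ v → ∃[ k ] k < period × iterate rotate r k ≡ d
    position d at-v = index d (trans at-v (sym (proj₁ is-root)))

    position-rotate : ∀ {d k k′} → k < period → iterate rotate r k ≡ d →
      k′ < period → iterate rotate r k′ ≡ rotate d → faceᵈ (rotate d) ≢ outer → odd k′ ≡ not (odd k)
    position-rotate {d} {k} {k′} k<p eq k′<p eq′ inner-corner with ℕ.m≤n⇒m<n∨m≡n k<p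
    ... | inj₁ 1+k<p = cong odd (unique k′<p 1+k<p
      (trans eq′ (sym (trans (iterate-suc rotate r k) (cong rotate eq)))))
    ... | inj₂ 1+k≡p = trans (cong odd (unique k′<p z<s (trans eq′ returns)))
                               (sym (restart (proj₂ is-root)))
      where
      returns : rotate d ≡ r
      returns = trans (sym (trans (iterate-suc rotate r k) (cong rotate eq)))
                      (trans (cong (iterate rotate r) 1+k≡p) closes)

      restart : faceᵈ r ≡ outer ⊎ Inner v → odd (suc k) ≡ false
      restart (inj₁ out)   = contradiction (trans (cong faceᵈ returns) out) inner-corner
      restart (inj₂ inner) = 2∣⇒odd≡false (subst (2 ∣_)
        (sym (trans 1+k≡p (trans period≡degree (cong degree (proj₁ is-root))))) (even v inner))

  -- The vertex is a separate argument so that all darts at `v` are visibly counted from the same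
  -- root.
  parity-at : ∀ v d → source d ≡ v → Bool
  parity-at v d at-v with root-at v
  ... | inj₁ (r , is-root) = odd (proj₁ (position is-root d at-v))
  ... | inj₂ none          = contradiction at-v (none d)

  parity-at-rotate : ∀ v d at-v at-v′ → faceᵈ (rotate d) ≢ outer →
                     parity-at v (rotate d) at-v′ ≡ not (parity-at v d at-v)
  parity-at-rotate v d at-v at-v′ inner-corner with root-at v
  ... | inj₁ (r , is-root) =
    let k  , k<p  , eq  = position is-root d at-v
        k′ , k′<p , eq′ = position is-root (rotate d) at-v′
    in position-rotate is-root k<p eq k′<p eq′ inner-corner
  ... | inj₂ none          = contradiction at-v (none d)

  parity : Dart → Bool
  parity d = parity-at (source d) d refl

  parity-rotate : ∀ d → faceᵈ (rotate d) ≢ outer → parity (rotate d) ≡ not (parity d)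
  parity-rotate d inner-corner = trans (rebase (rotate-source d))
    (parity-at-rotate (source d) d refl (rotate-source d) inner-corner)
    where
    rebase : ∀ {e v} (eq : source e ≡ v) → parity e ≡ parity-at v e eq
    rebase refl = refl

  face-nextᵈ : ∀ d → faceᵈ (nextᵈ d) ≡ faceᵈ d
  face-nextᵈ d = face-next (at d)

  inner-nextᵈ : ∀ {d} → faceᵈ d ≢ outer → faceᵈ (nextᵈ d) ≢ outer
  inner-nextᵈ {d} inner = inner ∘ trans (sym (face-nextᵈ d))

  parity-nextᵈ : ∀ d → faceᵈ d ≢ outer → parity (rev d) ≡ not (parity (nextᵈ d))
  parity-nextᵈ d inner = sym (trans (cong not (parity-rotate (rev d) (inner-nextᵈ inner)))
                                    (not-involutive _))

  module H¹ℤ₂ = Cohomology P triangulated (↔-sym 2↔Bool) xor-isGroup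
  module H¹ℤ₃ = Cohomology P triangulated (↔-id (Fin 3)) +₃-isGroup

  -- It marks the edges whose two darts have equal parities. A potential for it says at which
  -- vertices to flip all parities.
  parityDefect : Dart → Bool
  parityDefect d = not (parity d xor parity (rev d))

  -- In a triangle, `parity-nextᵈ` rewrites the parity of each reversed dart through the next dart,
  -- leaving the sum in `triple-xor`.
  parityDefect-cocycle : H¹ℤ₂.Cocycle parityDefect
  parityDefect-cocycle = record { antisymmetric = antisymmetric ; closed = closed }
    where
    antisymmetric : ∀ d → parityDefect (rev d) ≡ parityDefect d
    antisymmetric d = cong not (trans (cong (λ e → parity (rev d) xor parity e) (rev-involutive d))
                                      (xor-comm (parity (rev d)) (parity d)))

    closed : ∀ d → faceᵈ d ≢ outer →
             parityDefect d xor (parityDefect (nextᵈ d) xor parityDefect (nextᵈ (nextᵈ d))) ≡ false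
    closed d inner = begin
      parityDefect d xor (parityDefect d₁ xor parityDefect d₂)
        ≡⟨ cong₂ (λ x y → not (parity d xor x) xor (not (parity d₁ xor y) xor parityDefect d₂))
             (parity-nextᵈ d inner) (parity-nextᵈ d₁ inner₁) ⟩
      not (parity d xor not (parity d₁)) xor (not (parity d₁ xor not (parity d₂)) xor parityDefect d₂)
        ≡⟨ cong (λ z → not (parity d xor not (parity d₁)) xor (not (parity d₁ xor not (parity d₂)) xor not (parity d₂ xor z)))
             (trans (parity-nextᵈ d₂ (inner-nextᵈ inner₁)) (cong (not ∘ parity) (next³ inner))) ⟩
      not (parity d xor not (parity d₁)) xor (not (parity d₁ xor not (parity d₂)) xor not (parity d₂ xor not (parity d)))
        ≡⟨ triple-xor (parity d) (parity d₁) (parity d₂) ⟩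
      false ∎
      where
      open ≡-Reasoning
      d₁ d₂ : Dart
      d₁ = nextᵈ d
      d₂ = nextᵈ d₁

      inner₁ : faceᵈ d₁ ≢ outer
      inner₁ = inner-nextᵈ inner

  twist : Fin n → Bool
  twist = proj₁ (H¹ℤ₂.cocycle⇒coboundary parityDefect-cocycle)

  direction : Dart → Bool
  direction d = parity d xor twist (source d)

  direction-rev : ∀ d → direction (rev d) ≡ not (direction d)
  direction-rev d = xor-transpose (parity d) (parity (rev d)) (twist (source d)) (twist (target d))
    (proj₂ (H¹ℤ₂.cocycle⇒coboundary parityDefect-cocycle) d)

  -- `nextᵈ` first reverses and then rotates across a bounded corner; each of the two flips the
  -- direction.
  direction-nextᵈ : ∀ d → faceᵈ d ≢ outer → direction (nextᵈ d) ≡ direction d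
  direction-nextᵈ d inner = begin
    parity (nextᵈ d) xor twist (source (nextᵈ d))
      ≡⟨ cong₂ (λ b v → b xor twist v) (parity-rotate (rev d) (inner-nextᵈ inner)) (source-nextᵈ d) ⟩
    not (parity (rev d)) xor twist (target d)
      ≡⟨ not-distribˡ-xor (parity (rev d)) (twist (target d)) ⟨
    not (direction (rev d))
      ≡⟨ cong not (direction-rev d) ⟩
    not (not (direction d))
      ≡⟨ not-involutive (direction d) ⟩
    direction d ∎
    where open ≡-Reasoning

  -- The three signs around a triangle are equal, and three equal summands cancel in ℤ/3.
  direction-cocycle : H¹ℤ₃.Cocycle (sign ∘ direction)
  direction-cocycle = record
    { antisymmetric = λ d → trans (cong sign (direction-rev d)) (sign-not (direction d))
    ; closed        = closed
    }
    where
    closed : ∀ d → faceᵈ d ≢ outer →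
      sign (direction d) +₃ (sign (direction (nextᵈ d)) +₃ sign (direction (nextᵈ (nextᵈ d)))) ≡ 0F
    closed d inner = trans
      (cong₂ (λ x y → sign (direction d) +₃ (sign x +₃ sign y)) eq (trans (direction-nextᵈ (nextᵈ d) (inner-nextᵈ inner)) eq))
      (sign-triple (direction d))
      where
      eq : direction (nextᵈ d) ≡ direction d
      eq = direction-nextᵈ d inner

  colour : Fin n → Fin 3
  colour = proj₁ (H¹ℤ₃.cocycle⇒coboundary direction-cocycle)

  colour-proper : ∀ {u v} → Adj u v → colour u ≢ colour v
  colour-proper {u} {v} uv eq = sign≢0 (direction d) (begin
    sign (direction d)          ≡⟨ proj₂ (H¹ℤ₃.cocycle⇒coboundary direction-cocycle) d ⟨
    (-₃ colour u) +₃ colour v   ≡⟨ cong (λ x → (-₃ x) +₃ colour v) eq ⟩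
    (-₃ colour v) +₃ colour v   ≡⟨ IsGroup.inverseˡ +₃-isGroup (colour v) ⟩
    0F                          ∎)
    where
    open ≡-Reasoning
    d : Dart
    d = dart u v uv

theorem4 : (n : ℕ) (G : Graph n) (P : PlaneEmbedding G) →
    PlaneEmbedding.IsNearTriangulation P →
    ¬ ContainsInduced (complete 4) G →
    WordRepresentable G ⇔ PlaneEmbedding.InternallyEven P
theorem4 n G P triangulated no-K₄ = mk⇔
  (λ representable → NearTriangulation.representable⇒even P triangulated representable no-K₄)
  (λ even → ThreeColouring.wordRepresentable G
    (Colouring.colour P triangulated even) (Colouring.colour-proper P triangulated even))
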